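{- Let $d\ge 1$, let $W=\mathbb{R}^d$, and let $S\subseteq W$ be a closed convex polyhedron. Let $\phi:\mathbb{C}[x]\to M(S)$ be the surjective $\mathbb{C}$-algebra homomorphism determined by $\phi(x)=[S]$, and let $I=\ker(\phi)$. Then: (a) if $S=\emptyset$, then $I=(x)$; (b) if $S=\{0\}$, then $I=(x-1)$; (c) if $S\notin\{\emptyset,\{0\}\}$ and $S=2S$ (in particular for $S=W$), then $I=(x(x-1))$; (d) if $S\notin\{\emptyset,\{0\}\}$ and $S\neq 2S$ (in particular for a bounded convex polytope $S\notin\{\emptyset,\{0\}\}$), then $I=(0)$.
   Context: For $S\subseteq W=\mathbb{R}^d$, $[S]:W\to\mathbb{C}$ denotes its indicator function (so $[\emptyset]=0$). The Minkowski sum is $A+B=\{a+b:a\in A,b\in B\}$. Let $M(\mathcal{P}(W))$ be the complex vector space of functions on $W$ spanned by the indicator functions of closed convex polyhedra; it is a commutative $\mathbb{C}$-algebra with the well-defined bilinear product determined by $[A]\cdot[B]=[A+B]$ for nonempty closed convex polyhedra $A,B$, with unit $[\{0\}]$. For a closed convex polyhedron $S$, $M(S)$ is the unital $\mathbb{C}$-subalgebra of $M(\mathcal{P}(W))$ generated by $[S]$. Here $2S=\{2s:s\in S\}$. -}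

module Defs where

open import Algebra.Bundles using (CommutativeRing; RawRing)
import Algebra.Definitions.RawMonoid as RawMonoidDefinitions
open import Algebra.Morphism.Structures using (module RingMorphisms)
import Algebra.Properties.Ring as RingProperties
import Algebra.Solver.Ring.NaturalCoefficients.Default as NaturalCoefficients
open import Algebra.Structures using (IsCommutativeRing)
open import Data.Bool.Base using (if_then_else_)
open import Data.List.Base using (List; []; _∷_; map)
open import Data.List.Relation.Unary.All using (All; all?)
open import Data.Nat.Base using (ℕ; zero; suc)
open import Data.Product.Base using (∃-syntax; _×_; _,_)
open import Data.Vec.Functional using (Vector)
open import Level using (0ℓ) renaming (suc to lsuc)
open import Relation.Binary.Structures using (IsDecTotalOrder)
open import Relation.Nullary.Decidable.Core using (Dec; does)
open import Relation.Nullary.Negation.Core using (¬_)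
open import Relation.Unary using (Pred; Satisfiable; _≐_)

-- The library has no real numbers; ℝ is characterised (classically up to
-- unique isomorphism) as a Dedekind-complete ordered field.  The order is
-- decidable, as it is classically.
record RealNumbers : Set (lsuc 0ℓ) where
  infix 4 _≤_
  field
    commutativeRing : CommutativeRing 0ℓ 0ℓ
  open CommutativeRing commutativeRing public
  field
    _≤_             : Carrier → Carrier → Set
    isDecTotalOrder : IsDecTotalOrder _≈_ _≤_
    0≉1             : ¬ (0# ≈ 1#)
    inverse         : ∀ x → ¬ (x ≈ 0#) → ∃[ y ] x * y ≈ 1#
    +-monoˡ-≤       : ∀ {x y} z → x ≤ y → x + z ≤ y + z
    *-nonneg        : ∀ {x y} → 0# ≤ x → 0# ≤ y → 0# ≤ x * y
    supremum        : (A : Pred Carrier 0ℓ) → Satisfiable A →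
                      (∃[ b ] (∀ x → A x → x ≤ b)) →
                      ∃[ s ] ((∀ x → A x → x ≤ s) ×
                              (∀ b → (∀ x → A x → x ≤ b) → s ≤ b))
  open IsDecTotalOrder isDecTotalOrder public using (_≤?_; _≟_)

module ComplexNumbers (ℝ : RealNumbers) where
  private
    module R = RealNumbers ℝ
    open NaturalCoefficients R.commutativeSemiring
      using (solve; _:=_; _:+_; _:*_)
    open RingProperties R.ring using (-1*x≈-x)

  ℂ : Set
  ℂ = R.Carrier × R.Carrier

  infix  4 _≈_
  infixl 6 _+_
  infixl 7 _*_
  infix  8 -_

  _≈_ : ℂ → ℂ → Set
  (a , b) ≈ (c , d) = a R.≈ c × b R.≈ d

  _+_ _*_ : ℂ → ℂ → ℂ
  (a , b) + (c , d) = a R.+ c , b R.+ d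
  (a , b) * (c , d) = a R.* c R.+ R.- (b R.* d) , a R.* d R.+ b R.* c

  -_ : ℂ → ℂ
  - (a , b) = R.- a , R.- b

  0# 1# : ℂ
  0# = R.0# , R.0#
  1# = R.1# , R.0#

  private
    *-identityˡ : ∀ z → 1# * z ≈ z
    *-identityˡ (a , b) =
      R.trans (R.+-cong (R.*-identityˡ a)
                 (R.trans (R.-‿cong (R.zeroˡ b)) -0≈0))
              (R.+-identityʳ a) ,
      R.trans (R.+-cong (R.*-identityˡ b) (R.zeroˡ a)) (R.+-identityʳ b)
      where
      -0≈0 : R.- R.0# R.≈ R.0#
      -0≈0 = R.trans (R.sym (R.+-identityˡ _)) (R.-‿inverseʳ R.0#)

    m : R.Carrier
    m = R.- R.1#

    -≈m* : ∀ x → R.- x R.≈ m R.* x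
    -≈m* x = R.sym (-1*x≈-x x)

    *-comm : ∀ z w → z * w ≈ w * z
    *-comm (a , b) (c , d) =
      R.+-cong (R.*-comm a c) (R.-‿cong (R.*-comm b d)) ,
      solve 4 (λ a b c d → a :* d :+ b :* c := c :* b :+ d :* a) R.refl a b c d

    *-assoc : ∀ z w u → (z * w) * u ≈ z * (w * u)
    *-assoc (a , b) (c , d) (e , f) =
      R.trans (R.+-cong (R.*-congʳ (R.+-congˡ (-≈m* _))) (-≈m* _))
        (R.trans
          (solve 7 (λ m a b c d e f →
            (a :* c :+ m :* (b :* d)) :* e :+ m :* ((a :* d :+ b :* c) :* f)
            := a :* (c :* e :+ m :* (d :* f)) :+ m :* (b :* (c :* f :+ d :* e)))
            R.refl m a b c d e f)
          (R.sym (R.+-cong (R.*-congˡ (R.+-congˡ (-≈m* _))) (-≈m* _)))) ,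
      R.trans (R.+-congʳ (R.*-congʳ (R.+-congˡ (-≈m* _))))
        (R.trans
          (solve 7 (λ m a b c d e f →
            (a :* c :+ m :* (b :* d)) :* f :+ (a :* d :+ b :* c) :* e
            := a :* (c :* f :+ d :* e) :+ b :* (c :* e :+ m :* (d :* f)))
            R.refl m a b c d e f)
          (R.sym (R.+-congˡ (R.*-congˡ (R.+-congˡ (-≈m* _))))))

    distribˡ : ∀ z w u → z * (w + u) ≈ (z * w) + (z * u)
    distribˡ (a , b) (c , d) (e , f) =
      R.trans (R.+-congˡ (-≈m* _))
        (R.trans
          (solve 7 (λ m a b c d e f →
            a :* (c :+ e) :+ m :* (b :* (d :+ f))
            := (a :* c :+ m :* (b :* d)) :+ (a :* e :+ m :* (b :* f)))
            R.refl m a b c d e f)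
          (R.sym (R.+-cong (R.+-congˡ (-≈m* _)) (R.+-congˡ (-≈m* _))))) ,
      solve 6 (λ a b c d e f →
        a :* (d :+ f) :+ b :* (c :+ e)
        := (a :* d :+ b :* c) :+ (a :* f :+ b :* e))
        R.refl a b c d e f

    trans : ∀ {z w u} → z ≈ w → w ≈ u → z ≈ u
    trans (p , q) (r , s) = R.trans p r , R.trans q s

    +-cong : ∀ {z z′ w w′} → z ≈ z′ → w ≈ w′ → z + w ≈ z′ + w′
    +-cong (p , q) (r , s) = R.+-cong p r , R.+-cong q s

  isCommutativeRing : IsCommutativeRing _≈_ _+_ _*_ -_ 0# 1#
  isCommutativeRing = record
    { isRing = record
      { +-isAbelianGroup = record
        { isGroup = record
          { isMonoid = record
            { isSemigroup = record
              { isMagma = record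
                { isEquivalence = record
                  { refl  = R.refl , R.refl
                  ; sym   = λ (p , q) → R.sym p , R.sym q
                  ; trans = trans
                  }
                ; ∙-cong = +-cong
                }
              ; assoc = λ _ _ _ → R.+-assoc _ _ _ , R.+-assoc _ _ _
              }
            ; identity = (λ _ → R.+-identityˡ _ , R.+-identityˡ _)
                       , (λ _ → R.+-identityʳ _ , R.+-identityʳ _)
            }
          ; inverse = (λ _ → R.-‿inverseˡ _ , R.-‿inverseˡ _)
                    , (λ _ → R.-‿inverseʳ _ , R.-‿inverseʳ _)
          ; ⁻¹-cong = λ (p , q) → R.-‿cong p , R.-‿cong q
          }
        ; comm = λ _ _ → R.+-comm _ _ , R.+-comm _ _
        }
      ; *-cong = λ (p , q) (r , s) →
          R.+-cong (R.*-cong p r) (R.-‿cong (R.*-cong q s)) ,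
          R.+-cong (R.*-cong p s) (R.*-cong q r)
      ; *-assoc = *-assoc
      ; *-identity = *-identityˡ
                   , λ z → trans (*-comm z 1#) (*-identityˡ z)
      ; distrib = distribˡ
                , λ z w u → trans (*-comm (w + u) z)
                    (trans (distribˡ z w u) (+-cong (*-comm z w) (*-comm z u)))
      }
    ; *-comm = *-comm
    }

  ℂ-commutativeRing : CommutativeRing 0ℓ 0ℓ
  ℂ-commutativeRing = record { isCommutativeRing = isCommutativeRing }

module Polynomials (R : CommutativeRing 0ℓ 0ℓ) where
  open CommutativeRing R

  -- Coefficients in increasing degree; trailing zeros are allowed.
  Poly : Set
  Poly = List Carrier

  coeff : Poly → ℕ → Carrier
  coeff []      _       = 0#
  coeff (a ∷ _) zero    = a
  coeff (_ ∷ p) (suc n) = coeff p n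

  infix  4 _≈ₚ_
  infixl 6 _+ₚ_
  infixl 7 _*ₚ_
  infixr 7 _•ₚ_

  _≈ₚ_ : Poly → Poly → Set
  p ≈ₚ q = ∀ n → coeff p n ≈ coeff q n

  _+ₚ_ : Poly → Poly → Poly
  []      +ₚ q       = q
  (a ∷ p) +ₚ []      = a ∷ p
  (a ∷ p) +ₚ (b ∷ q) = a + b ∷ p +ₚ q

  _•ₚ_ : Carrier → Poly → Poly
  c •ₚ p = map (c *_) p

  _*ₚ_ : Poly → Poly → Poly
  []      *ₚ q = []
  (a ∷ p) *ₚ q = a •ₚ q +ₚ (0# ∷ p *ₚ q)

  -ₚ_ : Poly → Poly
  -ₚ p = map (-_) p

  0ₚ 1ₚ X : Poly
  0ₚ = []
  1ₚ = 1# ∷ []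
  X  = 0# ∷ 1# ∷ []

  rawRing-Poly : RawRing 0ℓ 0ℓ
  rawRing-Poly = record
    { _≈_ = _≈ₚ_ ; _+_ = _+ₚ_ ; _*_ = _*ₚ_ ; -_ = -ₚ_ ; 0# = 0ₚ ; 1# = 1ₚ }

  principalIdeal : Poly → Pred Poly 0ℓ
  principalIdeal q p = ∃[ r ] p ≈ₚ r *ₚ q

module Polyhedra (ℝ : RealNumbers) (d : ℕ) where
  private
    module R = RealNumbers ℝ
  open ComplexNumbers ℝ
  open Polynomials ℂ-commutativeRing public

  W : Set
  W = Vector R.Carrier d

  infix  4 _≈ᵂ_
  infixl 6 _+ᵂ_
  infixr 7 _•ᵂ_

  _≈ᵂ_ : W → W → Set
  v ≈ᵂ w = ∀ i → v i R.≈ w i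

  _+ᵂ_ : W → W → W
  (v +ᵂ w) i = v i R.+ w i

  _•ᵂ_ : R.Carrier → W → W
  (t •ᵂ v) i = t R.* v i

  0ᵂ : W
  0ᵂ _ = R.0#

  ⟨_,_⟩ : W → W → R.Carrier
  ⟨ v , w ⟩ = sum (λ i → v i R.* w i)
    where open RawMonoidDefinitions (RawRing.+-rawMonoid R.rawRing) using (sum)

  -- The subset {0}, as W carries a setoid equality.
  ｛0｝ : Pred W 0ℓ
  ｛0｝ w = w ≈ᵂ 0ᵂ

  infixl 6 _⊕_

  _⊕_ : Pred W 0ℓ → Pred W 0ℓ → Pred W 0ℓ
  (A ⊕ B) w = ∃[ a ] ∃[ b ] A a × B b × w ≈ᵂ a +ᵂ b

  twice : Pred W 0ℓ → Pred W 0ℓ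
  twice A w = ∃[ a ] A a × w ≈ᵂ (R.1# R.+ R.1#) •ᵂ a

  Bounded : Pred W 0ℓ → Set
  Bounded A = ∃[ r ] ∀ w → A w → ⟨ w , w ⟩ R.≤ r

  -- A closed convex polyhedron is a finite intersection of closed half-spaces
  -- { w ∣ ⟨ a , w ⟩ ≤ b }, given by the list of the pairs (a , b).  Different
  -- lists may describe the same subset ⟦ P ⟧; the empty set (a = 0, b < 0) and
  -- W (the empty list) are polyhedra.
  Polyhedron : Set
  Polyhedron = List (W × R.Carrier)

  ⟦_⟧ : Polyhedron → Pred W 0ℓ
  ⟦ P ⟧ w = All (λ (a , b) → ⟨ a , w ⟩ R.≤ b) P

  _∈?_ : ∀ w P → Dec (⟦ P ⟧ w)
  w ∈? P = all? (λ (a , b) → ⟨ a , w ⟩ R.≤? b) P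

  indicator : Polyhedron → W → ℂ
  indicator P w = if does (w ∈? P) then 1# else 0#

  data InSpan : Pred (W → ℂ) 0ℓ where
    indicator∈ : ∀ P → InSpan (indicator P)
    zero∈      : InSpan (λ _ → 0#)
    +∈         : ∀ {f g} → InSpan f → InSpan g → InSpan (λ w → f w + g w)
    •∈         : ∀ c {f} → InSpan f → InSpan (λ w → c * f w)
    resp∈      : ∀ {f g} → (∀ w → f w ≈ g w) → InSpan f → InSpan g

  -- M(𝒫(W))
  M : Set
  M = ∃[ f ] InSpan f

  infix  4 _≈ᴹ_
  infixl 6 _+ᴹ_
  infixr 7 _•ᴹ_

  _≈ᴹ_ : M → M → Set
  (f , _) ≈ᴹ (g , _) = ∀ w → f w ≈ g w

  _+ᴹ_ : M → M → M
  (f , f∈) +ᴹ (g , g∈) = _ , +∈ f∈ g∈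

  _•ᴹ_ : ℂ → M → M
  c •ᴹ (f , f∈) = _ , •∈ c f∈

  -ᴹ_ : M → M
  -ᴹ f = (- 1#) •ᴹ f

  0ᴹ : M
  0ᴹ = _ , zero∈

  [_] : Polyhedron → M
  [ P ] = _ , indicator∈ P

  -- The commutative ℂ-algebra structure on M(𝒫(W)).  On indicators the product
  -- is [A]·[B] = [A + B]; the Minkowski sum is again a polyhedron, of which C
  -- is any description.  By bilinearity these laws determine _·_ uniquely.
  record PolyhedraAlgebra : Set where
    infixl 7 _·_
    field
      _·_                 : M → M → M
      1ᴹ                  : M
      isCommutativeRing-M : IsCommutativeRing _≈ᴹ_ _+ᴹ_ _·_ -ᴹ_ 0ᴹ 1ᴹ
      •-·-assoc           : ∀ c f g → (c •ᴹ f) · g ≈ᴹ c •ᴹ (f · g)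
      indicator-·         : ∀ A B C → Satisfiable ⟦ A ⟧ → Satisfiable ⟦ B ⟧ →
                            ⟦ C ⟧ ≐ ⟦ A ⟧ ⊕ ⟦ B ⟧ → [ A ] · [ B ] ≈ᴹ [ C ]
      1ᴹ≈[0]              : ∀ Z → ⟦ Z ⟧ ≐ ｛0｝ → 1ᴹ ≈ᴹ [ Z ]

  module Subalgebra (𝓐 : PolyhedraAlgebra) (S : Polyhedron) where
    open PolyhedraAlgebra 𝓐

    data Generated : Pred M 0ℓ where
      gen∈  : Generated [ S ]
      1∈    : Generated 1ᴹ
      0∈    : Generated 0ᴹ
      +∈    : ∀ {f g} → Generated f → Generated g → Generated (f +ᴹ g)
      ·∈    : ∀ {f g} → Generated f → Generated g → Generated (f · g)
      •∈    : ∀ c {f} → Generated f → Generated (c •ᴹ f)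
      resp∈ : ∀ {f g} → f ≈ᴹ g → Generated f → Generated g

    M⟨S⟩ : Set
    M⟨S⟩ = ∃[ f ] Generated f

    gen : M⟨S⟩
    gen = [ S ] , gen∈

    infix  4 _≈ˢ_
    infixr 7 _•ˢ_

    _≈ˢ_ : M⟨S⟩ → M⟨S⟩ → Set
    (f , _) ≈ˢ (g , _) = f ≈ᴹ g

    _•ˢ_ : ℂ → M⟨S⟩ → M⟨S⟩
    c •ˢ (f , f∈) = c •ᴹ f , •∈ c f∈

    rawRing-M⟨S⟩ : RawRing 0ℓ 0ℓ
    rawRing-M⟨S⟩ = record
      { Carrier = M⟨S⟩
      ; _≈_     = _≈ˢ_
      ; _+_     = λ (f , f∈) (g , g∈) → f +ᴹ g , +∈ f∈ g∈
      ; _*_     = λ (f , f∈) (g , g∈) → f · g , ·∈ f∈ g∈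
      ; -_      = λ (f , f∈) → -ᴹ f , •∈ (- 1#) f∈
      ; 0#      = 0ᴹ , 0∈
      ; 1#      = 1ᴹ , 1∈
      }

    record IsAlgebraHomomorphism (φ : Poly → M⟨S⟩) : Set where
      open RingMorphisms rawRing-Poly rawRing-M⟨S⟩
      field
        isRingHomomorphism : IsRingHomomorphism φ
        •-homo             : ∀ c p → φ (c •ₚ p) ≈ˢ c •ˢ φ p

    kernel : (Poly → M⟨S⟩) → Pred Poly 0ℓ
    kernel φ p = φ p ≈ˢ (0ᴹ , 0∈)

-- With nS = S + … + S the homomorphism φ sends Σ cₙ xⁿ to Σ cₙ [nS].  If S ≠ 2S,
-- some ray from the origin leaves or enters S at a point v ≠ 0 lying on a facet
-- hyperplane ⟨ a , w ⟩ = b of S, and b ≠ 0 because the ray crosses the hyperplane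
-- there.  As ⟨ a , · ⟩ has maximum nb on nS, attained at nv, the point nv avoids mS
-- for all m < n (if b > 0) or for all m > n (if b < 0), so evaluating at the points
-- nv gives a triangular system and all cₙ vanish.  If S = 2S then S + S = S, and only
-- the values at 0 and at a nonzero point of S remain.  Emptiness of S and the
-- existence of v are only known up to double negation, which suffices since
-- equality in ℂ is decidable and hence equality of functions and of polynomials
-- is stable; the quotients witnessing membership in the ideals come from division.

module Submission where

open import Defs
open import Algebra.Bundles using (CommutativeRing)
open import Algebra.Morphism.Structures using (module RingMorphisms)
import Algebra.Properties.CommutativeMonoid.Sum as CommutativeMonoidSum
import Algebra.Properties.Group as GroupProperties
import Algebra.Properties.Ring as RingProperties
import Algebra.Properties.Semiring.Sum as SemiringSum
import Algebra.Solver.Ring.NaturalCoefficients.Default as NaturalCoefficients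
open import Data.Bool.Base using (if_then_else_)
open import Data.Fin.Base as Fin using (Fin; zero; suc)
import Data.Fin.Properties as Fin
open import Data.List.Base using (List; []; _∷_; _++_; map; tabulate)
open import Data.List.Relation.Unary.All as All using (All; []; _∷_)
import Data.List.Relation.Unary.All.Properties as All
open import Data.Nat.Base as ℕ using (ℕ; zero; suc; _≥_)
import Data.Nat.Properties as ℕ
open import Data.Product.Base using (∃-syntax; _×_; _,_; proj₁; proj₂)
open import Data.Sum.Base using (inj₁; inj₂)
open import Function.Base using (_∘_)
open import Function.Definitions using (Surjective)
open import Level using (0ℓ)
open import Relation.Binary.Bundles using (Poset)
import Relation.Binary.Reasoning.PartialOrder as PosetReasoning
import Relation.Binary.Reasoning.Setoid as SetoidReasoning
open import Relation.Binary.Structures using (IsDecTotalOrder)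
open import Relation.Binary.PropositionalEquality.Core as ≡ using (_≡_)
open import Relation.Nullary.Decidable.Core using (yes; no; does; decidable-stable; _×-dec_)
open import Relation.Nullary.Decidable using (dec-true; dec-false)
open import Relation.Nullary.Negation.Core using (¬_; contradiction)
open import Relation.Unary using (Pred; Satisfiable; _≐_; ∅; U)

-- Ordered field arithmetic: signs, inverses, halves, natural multiples and interpolation.

module OrderedField (ℝ : RealNumbers) where
  open RealNumbers ℝ hiding (zero)
  open IsDecTotalOrder isDecTotalOrder public
    using (total; antisym)
    renaming (refl to ≤-refl; reflexive to ≤-reflexive; trans to ≤-trans)
  open RingProperties ring
  open NaturalCoefficients commutativeSemiring

  poset : Poset 0ℓ 0ℓ 0ℓ
  poset = record { isPartialOrder = IsDecTotalOrder.isPartialOrder isDecTotalOrder }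

  open PosetReasoning poset

  +-mono-≤ : ∀ {x y u v} → x ≤ y → u ≤ v → x + u ≤ y + v
  +-mono-≤ {x} {y} {u} {v} x≤y u≤v = begin
    x + u  ≤⟨ +-monoˡ-≤ u x≤y ⟩
    y + u  ≈⟨ +-comm y u ⟩
    u + y  ≤⟨ +-monoˡ-≤ y u≤v ⟩
    v + y  ≈⟨ +-comm v y ⟩
    y + v  ∎

  +-nonneg : ∀ {x y} → 0# ≤ x → 0# ≤ y → 0# ≤ x + y
  +-nonneg 0≤x 0≤y = ≤-trans (≤-reflexive (sym (+-identityˡ 0#))) (+-mono-≤ 0≤x 0≤y)

  x≤x+y : ∀ x {y} → 0# ≤ y → x ≤ x + y
  x≤x+y x {y} 0≤y = begin
    x       ≈⟨ +-identityʳ x ⟨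
    x + 0#  ≤⟨ +-mono-≤ ≤-refl 0≤y ⟩
    x + y   ∎

  +-cancelʳ-≤ : ∀ z {x y} → x + z ≤ y + z → x ≤ y
  +-cancelʳ-≤ z {x} {y} le = begin
    x              ≈⟨ cancel x ⟨
    x + z + (- z)  ≤⟨ +-monoˡ-≤ (- z) le ⟩
    y + z + (- z)  ≈⟨ cancel y ⟩
    y              ∎
    where
    cancel : ∀ u → u + z + (- z) ≈ u
    cancel u = trans (+-assoc u z (- z)) (trans (+-congˡ (-‿inverseʳ z)) (+-identityʳ u))

  gap : ∀ {x y} → x ≤ y → ∃[ p ] 0# ≤ p × x + p ≈ y
  gap {x} {y} x≤y = y + (- x) , 0≤y-x , (begin-equality
    x + (y + (- x))  ≈⟨ +-comm x _ ⟩
    y + (- x) + x    ≈⟨ +-assoc y (- x) x ⟩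
    y + (- x + x)    ≈⟨ +-congˡ (-‿inverseˡ x) ⟩
    y + 0#           ≈⟨ +-identityʳ y ⟩
    y                ∎)
    where
    0≤y-x : 0# ≤ y + (- x)
    0≤y-x = ≤-trans (≤-reflexive (sym (-‿inverseʳ x))) (+-monoˡ-≤ (- x) x≤y)

  neg-nonneg : ∀ {x} → x ≤ 0# → 0# ≤ - x
  neg-nonneg {x} x≤0 with p , 0≤p , x+p≈0 ← gap x≤0 =
    ≤-trans 0≤p (≤-reflexive (inverseʳ-unique x p x+p≈0))
    where open GroupProperties +-group

  *-monoˡ-≤-nonneg : ∀ {c x y} → 0# ≤ c → x ≤ y → c * x ≤ c * y
  *-monoˡ-≤-nonneg {c} {x} {y} 0≤c x≤y with p , 0≤p , x+p≈y ← gap x≤y = begin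
    c * x          ≤⟨ x≤x+y (c * x) (*-nonneg 0≤c 0≤p) ⟩
    c * x + c * p  ≈⟨ distribˡ c x p ⟨
    c * (x + p)    ≈⟨ *-congˡ x+p≈y ⟩
    c * y          ∎

  square-nonneg : ∀ x → 0# ≤ x * x
  square-nonneg x with total 0# x
  ... | inj₁ 0≤x = *-nonneg 0≤x 0≤x
  ... | inj₂ x≤0 = begin
    0#             ≤⟨ *-nonneg (neg-nonneg x≤0) (neg-nonneg x≤0) ⟩
    - x * - x      ≈⟨ -‿distribˡ-* x (- x) ⟨
    - (x * - x)    ≈⟨ -‿cong (-‿distribʳ-* x x) ⟨
    - (- (x * x))  ≈⟨ ⁻¹-involutive (x * x) ⟩
    x * x          ∎
    where open GroupProperties +-group

  0≤1 : 0# ≤ 1#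
  0≤1 = ≤-trans (square-nonneg 1#) (≤-reflexive (*-identityˡ 1#))

  -- Since `x * y` is one, `y` equals `y * y * x`, a square times a nonnegative number.
  inverse-nonneg : ∀ {x y} → 0# ≤ x → x * y ≈ 1# → 0# ≤ y
  inverse-nonneg {x} {y} 0≤x xy≈1 = begin
    0#           ≤⟨ *-nonneg (square-nonneg y) 0≤x ⟩
    y * y * x    ≈⟨ solve 2 (λ x y → y :* y :* x := y :* (x :* y)) refl x y ⟩
    y * (x * y)  ≈⟨ *-congˡ xy≈1 ⟩
    y * 1#       ≈⟨ *-identityʳ y ⟩
    y            ∎

  *-cancelˡ-≈0 : ∀ {x y} → ¬ (x ≈ 0#) → x * y ≈ 0# → y ≈ 0#
  *-cancelˡ-≈0 {x} {y} x≉0 xy≈0 with z , xz≈1 ← inverse x x≉0 = begin-equality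
    y            ≈⟨ *-identityˡ y ⟨
    1# * y       ≈⟨ *-congʳ xz≈1 ⟨
    x * z * y    ≈⟨ solve 3 (λ x y z → x :* z :* y := z :* (x :* y)) refl x y z ⟩
    z * (x * y)  ≈⟨ *-congˡ xy≈0 ⟩
    z * 0#       ≈⟨ zeroʳ z ⟩
    0#           ∎

  square≈0⇒≈0 : ∀ {x} → x * x ≈ 0# → x ≈ 0#
  square≈0⇒≈0 {x} xx≈0 =
    decidable-stable (x ≟ 0#) λ x≉0 → x≉0 (*-cancelˡ-≈0 x≉0 xx≈0)

  sum-nonneg≈0 : ∀ {x y} → 0# ≤ x → 0# ≤ y → x + y ≈ 0# → x ≈ 0# × y ≈ 0#
  sum-nonneg≈0 {x} {y} 0≤x 0≤y x+y≈0 =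
    antisym (≤-trans (x≤x+y x 0≤y) (≤-reflexive x+y≈0)) 0≤x ,
    antisym (≤-trans (x≤x+y y 0≤x) (≤-reflexive (trans (+-comm y x) x+y≈0))) 0≤y

  2# ½ : Carrier
  2# = 1# + 1#
  private
    2≉0 : ¬ (2# ≈ 0#)
    2≉0 2≈0 = 0≉1 (sym (proj₁ (sum-nonneg≈0 0≤1 0≤1 2≈0)))
  ½ = proj₁ (inverse 2# 2≉0)

  2*½≈1 : 2# * ½ ≈ 1#
  2*½≈1 = proj₂ (inverse 2# 2≉0)

  2*[½*x]≈x : ∀ x → 2# * (½ * x) ≈ x
  2*[½*x]≈x x = trans (sym (*-assoc 2# ½ x)) (trans (*-congʳ 2*½≈1) (*-identityˡ x))

  0≤2 : 0# ≤ 2#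
  0≤2 = +-nonneg 0≤1 0≤1

  0≤½ : 0# ≤ ½
  0≤½ = inverse-nonneg 0≤2 2*½≈1

  ½+½≈1 : ½ + ½ ≈ 1#
  ½+½≈1 = trans (solve 1 (λ h → h :+ h := (con 1 :+ con 1) :* h) refl ½) 2*½≈1

  ι : ℕ → Carrier
  ι zero    = 0#
  ι (suc n) = 1# + ι n

  ι-nonneg : ∀ n → 0# ≤ ι n
  ι-nonneg zero    = ≤-refl
  ι-nonneg (suc n) = +-nonneg 0≤1 (ι-nonneg n)

  ι-suc≉0 : ∀ n → ¬ (ι (suc n) ≈ 0#)
  ι-suc≉0 n eq = 0≉1 (sym (proj₁ (sum-nonneg≈0 0≤1 (ι-nonneg n) eq)))

  ι-mono : ∀ {m n} → m ℕ.≤ n → ι m ≤ ι n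
  ι-mono {n = n} ℕ.z≤n = ι-nonneg n
  ι-mono (ℕ.s≤s m≤n)   = +-mono-≤ ≤-refl (ι-mono m≤n)

  -- From m + 1 ≤ n and h ≥ 0 follows h + mh ≤ nh ≤ mh, and mh cancels. It separates the multiples
  -- of a polyhedron by the heights of their supporting hyperplanes.
  ι-*-cancel-nonneg : ∀ {m n h} → m ℕ.< n → 0# ≤ h → ι n * h ≤ ι m * h → h ≤ 0#
  ι-*-cancel-nonneg {m} {n} {h} m<n 0≤h le = +-cancelʳ-≤ (ι m * h) (begin
    h + ι m * h       ≈⟨ solve 2 (λ h m → h :+ m :* h := h :* (con 1 :+ m)) refl h (ι m) ⟩
    h * ι (suc m)     ≤⟨ *-monoˡ-≤-nonneg 0≤h (ι-mono m<n) ⟩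
    h * ι n           ≈⟨ *-comm h (ι n) ⟩
    ι n * h           ≤⟨ le ⟩
    ι m * h           ≈⟨ +-identityˡ _ ⟨
    0# + ι m * h      ∎)

  -- With m = 1 + n + p and p ≥ 0, the term ph is nonpositive, so nh ≤ mh ≤ h + nh.
  ι-*-cancel-nonpos : ∀ {m n h} → n ℕ.< m → h ≤ 0# → ι n * h ≤ ι m * h → 0# ≤ h
  ι-*-cancel-nonpos {m} {n} {h} n<m h≤0 le with p , 0≤p , 1+n+p≈m ← gap (ι-mono n<m) =
    +-cancelʳ-≤ (ι n * h) (begin
      0# + ι n * h             ≈⟨ +-identityˡ _ ⟩
      ι n * h                  ≤⟨ le ⟩
      ι m * h                  ≈⟨ *-congʳ 1+n+p≈m ⟨
      (1# + ι n + p) * h       ≈⟨ solve 3 (λ h n p →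
        (con 1 :+ n :+ p) :* h := (h :+ n :* h) :+ p :* h) refl h (ι n) p ⟩
      (h + ι n * h) + p * h    ≤⟨ +-mono-≤ ≤-refl (*-monoˡ-≤-nonneg 0≤p h≤0) ⟩
      (h + ι n * h) + p * 0#   ≈⟨ +-congˡ (zeroʳ p) ⟩
      (h + ι n * h) + 0#       ≈⟨ +-identityʳ _ ⟩
      h + ι n * h              ∎)

  interpolate : ∀ {x y b} → x ≤ b → b ≤ y → ¬ (x ≈ y) →
                ∃[ α ] ∃[ β ] 0# ≤ α × 0# ≤ β × α + β ≈ 1# × α * x + β * y ≈ b
  interpolate {x} {y} {b} x≤b b≤y x≉y
    with p , 0≤p , x+p≈b ← gap x≤b | q , 0≤q , b+q≈y ← gap b≤y =
    -- The point `b` lies at distances p and q from `x` and `y`, so the weights are q / (p + q) and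
    -- p / (p + q); `e` is the inverse of p + q.
    q * e , p * e , *-nonneg 0≤q 0≤e , *-nonneg 0≤p 0≤e ,
    trans (solve 3 (λ p q e → q :* e :+ p :* e := (p :+ q) :* e) refl p q e) [p+q]e≈1 ,
    (begin-equality
      q * e * x + p * e * y              ≈⟨ +-congˡ (*-congˡ x+p+q≈y) ⟨
      q * e * x + p * e * (x + p + q)    ≈⟨ solve 4 (λ p q e x →
        q :* e :* x :+ p :* e :* (x :+ p :+ q) := (p :+ q) :* e :* (x :+ p)) refl p q e x ⟩
      (p + q) * e * (x + p)              ≈⟨ *-congʳ [p+q]e≈1 ⟩
      1# * (x + p)                       ≈⟨ *-identityˡ _ ⟩
      x + p                              ≈⟨ x+p≈b ⟩
      b                                  ∎)
    where
    x+p+q≈y : x + p + q ≈ y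
    x+p+q≈y = trans (+-congʳ x+p≈b) b+q≈y
    p+q≉0 : ¬ (p + q ≈ 0#)
    p+q≉0 p+q≈0 = x≉y (begin-equality
      x            ≈⟨ +-identityʳ x ⟨
      x + 0#       ≈⟨ +-congˡ p+q≈0 ⟨
      x + (p + q)  ≈⟨ +-assoc x p q ⟨
      x + p + q    ≈⟨ x+p+q≈y ⟩
      y            ∎)
    e = proj₁ (inverse (p + q) p+q≉0)
    [p+q]e≈1 = proj₂ (inverse (p + q) p+q≉0)
    0≤e = inverse-nonneg (+-nonneg 0≤p 0≤q) [p+q]e≈1

-- The inner product and convexity of polyhedra.

module Geometry (ℝ : RealNumbers) (d : ℕ) where
  open RealNumbers ℝ hiding (zero)
  open OrderedField ℝ
  open Polyhedra ℝ d using
    (W; _≈ᵂ_; _+ᵂ_; _•ᵂ_; 0ᵂ; ⟨_,_⟩; ｛0｝; _⊕_; twice; Bounded; Polyhedron; ⟦_⟧; _∈?_)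
  open CommutativeMonoidSum +-commutativeMonoid using (sum; sum-cong-≋; sum-replicate-zero; ∑-distrib-+)
  open SemiringSum semiring using (*-distribˡ-sum)
  open RingProperties ring using (-1*x≈-x)
  open NaturalCoefficients commutativeSemiring using (solve; _:=_; _:+_; _:*_; con)
  open PosetReasoning poset

  ⟨⟩-congˡ : ∀ a {v w} → v ≈ᵂ w → ⟨ a , v ⟩ ≈ ⟨ a , w ⟩
  ⟨⟩-congˡ a v≈w = sum-cong-≋ λ i → *-congˡ (v≈w i)

  ⟨⟩-•ʳ : ∀ a t w → ⟨ a , t •ᵂ w ⟩ ≈ t * ⟨ a , w ⟩
  ⟨⟩-•ʳ a t w = trans
    (sum-cong-≋ λ i → solve 3 (λ a t w → a :* (t :* w) := t :* (a :* w)) refl (a i) t (w i))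
    (sym (*-distribˡ-sum t λ i → a i * w i))

  ⟨⟩-+ʳ : ∀ a v w → ⟨ a , v +ᵂ w ⟩ ≈ ⟨ a , v ⟩ + ⟨ a , w ⟩
  ⟨⟩-+ʳ a v w = trans (sum-cong-≋ λ i → distribˡ (a i) (v i) (w i))
                      (∑-distrib-+ (λ i → a i * v i) (λ i → a i * w i))

  ⟨⟩-combination : ∀ a α v β w → ⟨ a , α •ᵂ v +ᵂ β •ᵂ w ⟩ ≈ α * ⟨ a , v ⟩ + β * ⟨ a , w ⟩
  ⟨⟩-combination a α v β w =
    trans (⟨⟩-+ʳ a (α •ᵂ v) (β •ᵂ w)) (+-cong (⟨⟩-•ʳ a α v) (⟨⟩-•ʳ a β w))

  ⟨⟩-zeroʳ : ∀ a {w} → w ≈ᵂ 0ᵂ → ⟨ a , w ⟩ ≈ 0#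
  ⟨⟩-zeroʳ a w≈0 = trans (sum-cong-≋ λ i → trans (*-congˡ (w≈0 i)) (zeroʳ (a i)))
                         (sum-replicate-zero d)

  -- Stated for every length `n`, so that induction on the length applies; both claims are proved
  -- together because the second needs the nonnegativity of the remaining sum.
  ⟨⟩-definite : ∀ {n} (w : Fin n → Carrier) →
                0# ≤ sum (λ i → w i * w i) ×
                (sum (λ i → w i * w i) ≈ 0# → ∀ i → w i ≈ 0#)
  ⟨⟩-definite {zero}  w = ≤-refl , λ _ ()
  ⟨⟩-definite {suc n} w with ih₁ , ih₂ ← ⟨⟩-definite (w ∘ suc) =
    +-nonneg (square-nonneg (w zero)) ih₁ , λ eq →
      let eq₁ , eq₂ = sum-nonneg≈0 (square-nonneg (w zero)) ih₁ eq in
      λ { zero → square≈0⇒≈0 eq₁ ; (suc i) → ih₂ eq₂ i }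

  ≈0ᵂ-stable : ∀ w → ¬ ¬ (w ≈ᵂ 0ᵂ) → w ≈ᵂ 0ᵂ
  ≈0ᵂ-stable w ¬¬w≈0 i = decidable-stable (w i ≟ 0#) λ wᵢ≉0 → ¬¬w≈0 λ w≈0 → wᵢ≉0 (w≈0 i)

  ⟦⟧-resp : ∀ P {v w} → v ≈ᵂ w → ⟦ P ⟧ v → ⟦ P ⟧ w
  ⟦⟧-resp P v≈w = All.map λ {(a , b)} le →
    ≤-trans (≤-reflexive (sym (⟨⟩-congˡ a v≈w))) le

  ⟦⟧-convex : ∀ P {v w α β} → 0# ≤ α → 0# ≤ β → α + β ≈ 1# →
              ⟦ P ⟧ v → ⟦ P ⟧ w → ⟦ P ⟧ (α •ᵂ v +ᵂ β •ᵂ w)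
  ⟦⟧-convex P {v} {w} {α} {β} 0≤α 0≤β α+β≈1 v∈P w∈P =
    All.zipWith (λ {(a , b)} (v≤b , w≤b) → begin
      ⟨ a , α •ᵂ v +ᵂ β •ᵂ w ⟩       ≈⟨ ⟨⟩-combination a α v β w ⟩
      α * ⟨ a , v ⟩ + β * ⟨ a , w ⟩  ≤⟨ +-mono-≤ (*-monoˡ-≤-nonneg 0≤α v≤b) (*-monoˡ-≤-nonneg 0≤β w≤b) ⟩
      α * b + β * b                  ≈⟨ distribʳ b α β ⟨
      (α + β) * b                    ≈⟨ *-congʳ α+β≈1 ⟩
      1# * b                         ≈⟨ *-identityˡ b ⟩
      b                              ∎) (v∈P , w∈P)

  -- Multiples of coordinate vectors, and the origin as a polyhedron.

  unit : Fin d → Carrier → W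
  unit i c j = if does (i Fin.≟ j) then c else 0#

  ⟨unit,⟩ : ∀ i c w → ⟨ unit i c , w ⟩ ≈ c * w i
  ⟨unit,⟩ = go
    where
    go : ∀ {n} (i : Fin n) c (w : Fin n → Carrier) →
         sum (λ j → (if does (i Fin.≟ j) then c else 0#) * w j) ≈ c * w i
    go {suc n} zero    c w = trans (+-congˡ (trans (sum-cong-≋ λ j → zeroˡ (w (suc j))) (sum-replicate-zero n)))
                             (+-identityʳ _)
    go {suc n} (suc i) c w = trans (+-cong (zeroˡ _) (go i c (w ∘ suc))) (+-identityˡ _)

  -- The half-spaces wᵢ ≤ 0 and -wᵢ ≤ 0 for all i. A concrete description of {0} makes the unit of
  -- the algebra an explicit indicator function.
  origin : Polyhedron
  origin = tabulate (λ i → unit i 1# , 0#) ++ tabulate (λ i → unit i (- 1#) , 0#)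

  origin≐｛0｝ : ⟦ origin ⟧ ≐ ｛0｝
  origin≐｛0｝ = to , from
    where
    to : ∀ {w} → ⟦ origin ⟧ w → ｛0｝ w
    to {w} w∈ i with ps , qs ← All.++⁻ (tabulate λ i → unit i 1# , 0#) w∈ = antisym
      (begin
        w i                  ≈⟨ *-identityˡ (w i) ⟨
        1# * w i             ≈⟨ ⟨unit,⟩ i 1# w ⟨
        ⟨ unit i 1# , w ⟩    ≤⟨ All.tabulate⁻ ps i ⟩
        0#                   ∎)
      (begin
        0#                           ≤⟨ neg-nonneg (All.tabulate⁻ qs i) ⟩
        - ⟨ unit i (- 1#) , w ⟩      ≈⟨ -‿cong (⟨unit,⟩ i (- 1#) w) ⟩
        - (- 1# * w i)               ≈⟨ -‿cong (-1*x≈-x (w i)) ⟩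
        - - w i                      ≈⟨ ⁻¹-involutive (w i) ⟩
        w i                          ∎)
      where
      open GroupProperties +-group using (⁻¹-involutive)
    from : ∀ {w} → ｛0｝ w → ⟦ origin ⟧ w
    from w≈0 = All.++⁺ (All.tabulate⁺ λ i → ≤-reflexive (⟨⟩-zeroʳ (unit i 1#) w≈0))
                       (All.tabulate⁺ λ i → ≤-reflexive (⟨⟩-zeroʳ (unit i (- 1#)) w≈0))

  -- The multiples nP, as lists of half-spaces and as sets of scaled points.

  multiple : Polyhedron → ℕ → Polyhedron
  -- Scaling the right-hand sides by zero would give, for nonempty `P`, the recession cone of `P`
  -- instead of {0}.
  multiple P zero      = origin
  multiple P n@(suc _) = map (λ (a , b) → a , ι n * b) P

  dilation : Polyhedron → ℕ → Pred W 0ℓ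
  dilation P n w = ∃[ s ] ⟦ P ⟧ s × w ≈ᵂ ι n •ᵂ s

  multiple≐dilation : ∀ P n → Satisfiable ⟦ P ⟧ → ⟦ multiple P n ⟧ ≐ dilation P n
  multiple≐dilation P zero (s , s∈P) =
    (λ w∈ → s , s∈P , λ i → trans (proj₁ origin≐｛0｝ w∈ i) (sym (zeroˡ (s i)))) ,
    (λ (s , _ , w≈0s) → proj₂ origin≐｛0｝ λ i → trans (w≈0s i) (zeroˡ (s i)))
  multiple≐dilation P n@(suc m) _ = to , from
    where
    e = proj₁ (inverse (ι n) (ι-suc≉0 m))
    ne≈1 = proj₂ (inverse (ι n) (ι-suc≉0 m))
    0≤e = inverse-nonneg (ι-nonneg n) ne≈1
    n*e*x≈x : ∀ x → ι n * (e * x) ≈ x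
    n*e*x≈x x = trans (sym (*-assoc _ _ _)) (trans (*-congʳ ne≈1) (*-identityˡ x))
    e*n*x≈x : ∀ x → e * (ι n * x) ≈ x
    e*n*x≈x x = trans (solve 3 (λ e n x → e :* (n :* x) := n :* (e :* x)) refl e (ι n) x) (n*e*x≈x x)
    to : ∀ {w} → ⟦ multiple P n ⟧ w → dilation P n w
    to {w} w∈ = e •ᵂ w , All.map (λ {(a , b)} le → begin
      ⟨ a , e •ᵂ w ⟩  ≈⟨ ⟨⟩-•ʳ a e w ⟩
      e * ⟨ a , w ⟩   ≤⟨ *-monoˡ-≤-nonneg 0≤e le ⟩
      e * (ι n * b)   ≈⟨ e*n*x≈x b ⟩
      b               ∎) (All.map⁻ w∈) , λ i → sym (n*e*x≈x (w i))
    from : ∀ {w} → dilation P n w → ⟦ multiple P n ⟧ w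
    from {w} (s , s∈P , w≈ns) = All.map⁺ (All.map (λ {(a , b)} le → begin
      ⟨ a , w ⟩         ≈⟨ ⟨⟩-congˡ a w≈ns ⟩
      ⟨ a , ι n •ᵂ s ⟩  ≈⟨ ⟨⟩-•ʳ a (ι n) s ⟩
      ι n * ⟨ a , s ⟩   ≤⟨ *-monoˡ-≤-nonneg (ι-nonneg n) le ⟩
      ι n * b           ∎) s∈P)

  -- One inclusion splits (n + 1)s as s + ns. The other is convexity: s + ns′ is n + 1 times the
  -- weighted mean of s and s′ with weights 1 / (n + 1) and n / (n + 1).
  dilation-suc : ∀ P n → dilation P (suc n) ≐ ⟦ P ⟧ ⊕ dilation P n
  dilation-suc P n = to , from
    where
    to : ∀ {w} → dilation P (suc n) w → (⟦ P ⟧ ⊕ dilation P n) w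
    to (s , s∈P , w≈) = s , ι n •ᵂ s , s∈P , (s , s∈P , λ _ → refl) , λ i →
      trans (w≈ i) (trans (distribʳ (s i) 1# (ι n)) (+-congʳ (*-identityˡ (s i))))
    e = proj₁ (inverse (ι (suc n)) (ι-suc≉0 n))
    [1+n]e≈1 = proj₂ (inverse (ι (suc n)) (ι-suc≉0 n))
    0≤e = inverse-nonneg (ι-nonneg (suc n)) [1+n]e≈1
    from : ∀ {w} → (⟦ P ⟧ ⊕ dilation P n) w → dilation P (suc n) w
    from {w} (s , t , s∈P , (s′ , s′∈P , t≈ns′) , w≈s+t) =
      e •ᵂ s +ᵂ (e * ι n) •ᵂ s′ ,
      ⟦⟧-convex P 0≤e (*-nonneg 0≤e (ι-nonneg n))
        (trans (solve 2 (λ e n → e :+ e :* n := (con 1 :+ n) :* e) refl e (ι n)) [1+n]e≈1)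
        s∈P s′∈P ,
      λ i → begin-equality
        w i                                                ≈⟨ w≈s+t i ⟩
        s i + t i                                          ≈⟨ +-congˡ (t≈ns′ i) ⟩
        s i + ι n * s′ i                                   ≈⟨ *-identityˡ _ ⟨
        1# * (s i + ι n * s′ i)                            ≈⟨ *-congʳ [1+n]e≈1 ⟨
        ι (suc n) * e * (s i + ι n * s′ i)                 ≈⟨ solve 5 (λ m e n s s′ →
          m :* e :* (s :+ n :* s′) := m :* (e :* s :+ e :* n :* s′)) refl (ι (suc n)) e (ι n) (s i) (s′ i) ⟩
        ι (suc n) * (e * s i + e * ι n * s′ i)             ∎

  multiple-suc : ∀ P n → Satisfiable ⟦ P ⟧ → ⟦ multiple P (suc n) ⟧ ≐ ⟦ P ⟧ ⊕ ⟦ multiple P n ⟧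
  multiple-suc P n sat =
    (λ w∈ → let s , t , s∈ , t∈ , w≈ = proj₁ (dilation-suc P n) (proj₁ (multiple≐dilation P (suc n) sat) w∈)
            in s , t , s∈ , proj₂ (multiple≐dilation P n sat) t∈ , w≈) ,
    (λ (s , t , s∈ , t∈ , w≈) → proj₂ (multiple≐dilation P (suc n) sat) (proj₂ (dilation-suc P n)
       (s , t , s∈ , proj₁ (multiple≐dilation P n sat) t∈ , w≈)))

  -- A point 2s of `P` is s + s; conversely s + t is twice the midpoint of s and t, which lies in
  -- `P` by convexity.
  ⊕-idem : ∀ P → ⟦ P ⟧ ≐ twice ⟦ P ⟧ → ⟦ P ⟧ ≐ ⟦ P ⟧ ⊕ ⟦ P ⟧
  ⊕-idem P (P⊆2P , 2P⊆P) = to , from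
    where
    to : ∀ {w} → ⟦ P ⟧ w → (⟦ P ⟧ ⊕ ⟦ P ⟧) w
    to w∈ with s , s∈ , w≈2s ← P⊆2P w∈ =
      s , s , s∈ , s∈ , λ i → trans (w≈2s i)
        (solve 1 (λ s → (con 1 :+ con 1) :* s := s :+ s) refl (s i))
    from : ∀ {w} → (⟦ P ⟧ ⊕ ⟦ P ⟧) w → ⟦ P ⟧ w
    from {w} (s , t , s∈ , t∈ , w≈) = 2P⊆P
      (½ •ᵂ s +ᵂ ½ •ᵂ t , ⟦⟧-convex P 0≤½ 0≤½ ½+½≈1 s∈ t∈ , λ i → begin-equality
        w i                        ≈⟨ w≈ i ⟩
        s i + t i                  ≈⟨ 2*[½*x]≈x _ ⟨
        2# * (½ * (s i + t i))     ≈⟨ *-congˡ (distribˡ ½ (s i) (t i)) ⟩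
        2# * (½ * s i + ½ * t i)   ∎)

  -- Supporting hyperplanes that miss the origin, found by following rays.

  record Support (P : Polyhedron) : Set where
    field
      normal  : W
      point   : W
      point∈  : ⟦ P ⟧ point
      maximal : ∀ w → ⟦ P ⟧ w → ⟨ normal , w ⟩ ≤ ⟨ normal , point ⟩
      nonzero : ¬ (⟨ normal , point ⟩ ≈ 0#)

  private
    -- A point τs, τ ≥ 0, where the ray through s meets the boundary of P.
    record Exit (P : Polyhedron) (s : W) : Set where
      field
        scale   : Carrier
        0≤scale : 0# ≤ scale
        normal  : W
        point∈  : ⟦ P ⟧ (scale •ᵂ s)
        maximal : ∀ w → ⟦ P ⟧ w → ⟨ normal , w ⟩ ≤ ⟨ normal , scale •ᵂ s ⟩
        nonzero : ¬ (⟨ normal , scale •ᵂ s ⟩ ≈ 0#)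

    -- The segment from s to cs stays in `P` and crosses the hyperplane ⟨a, w⟩ = b. The crossing
    -- point αs + βcs is again on the ray, with scale α + βc.
    exit-at : ∀ {a b P s c} → ⟦ (a , b) ∷ P ⟧ s → 0# ≤ c →
              ⟦ P ⟧ (c •ᵂ s) → ¬ (⟨ a , c •ᵂ s ⟩ ≤ b) →
              ∃[ α ] ∃[ β ] 0# ≤ α × 0# ≤ β × α + β ≈ 1# × α * ⟨ a , s ⟩ + β * ⟨ a , c •ᵂ s ⟩ ≈ b →
              Exit ((a , b) ∷ P) s
    exit-at {a} {b} {P} {s} {c} (as≤b ∷ s∈P) 0≤c cs∈P acs≰b (α , β , 0≤α , 0≤β , α+β≈1 , eq) = record
      { scale   = τ
      ; 0≤scale = +-nonneg 0≤α (*-nonneg 0≤β 0≤c)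
      ; normal  = a
      ; point∈  = ≤-reflexive aτs≈b ∷
                  ⟦⟧-resp P (λ i → sym (τs≈ i)) (⟦⟧-convex P 0≤α 0≤β α+β≈1 s∈P cs∈P)
      ; maximal = λ { w (aw≤b ∷ _) → ≤-trans aw≤b (≤-reflexive (sym aτs≈b)) }
      ; nonzero = λ aτs≈0 → b≉0 (trans (sym aτs≈b) aτs≈0)
      }
      where
      τ = α + β * c
      τs≈ : τ •ᵂ s ≈ᵂ α •ᵂ s +ᵂ β •ᵂ (c •ᵂ s)
      τs≈ i = trans (distribʳ (s i) α (β * c)) (+-congˡ (*-assoc β c (s i)))
      aτs≈b : ⟨ a , τ •ᵂ s ⟩ ≈ b
      aτs≈b = trans (⟨⟩-congˡ a τs≈) (trans (⟨⟩-combination a α s β (c •ᵂ s)) eq)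
      -- If b = 0, the half-space is closed under scaling by c ≥ 0 and would contain cs along with
      -- s.
      b≉0 : ¬ (b ≈ 0#)
      b≉0 b≈0 = acs≰b (begin
        ⟨ a , c •ᵂ s ⟩  ≈⟨ ⟨⟩-•ʳ a c s ⟩
        c * ⟨ a , s ⟩   ≤⟨ *-monoˡ-≤-nonneg 0≤c as≤b ⟩
        c * b           ≈⟨ *-congˡ b≈0 ⟩
        c * 0#          ≈⟨ zeroʳ c ⟩
        0#              ≈⟨ b≈0 ⟨
        b               ∎)

    exit-through : ∀ {a b P s c} → ⟦ (a , b) ∷ P ⟧ s → 0# ≤ c →
                   ⟦ P ⟧ (c •ᵂ s) → ¬ (⟨ a , c •ᵂ s ⟩ ≤ b) → Exit ((a , b) ∷ P) s
    exit-through {a} {b} {P} {s} {c} s∈@(as≤b ∷ _) 0≤c cs∈P acs≰b with total b ⟨ a , c •ᵂ s ⟩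
    ... | inj₂ acs≤b = contradiction acs≤b acs≰b
    ... | inj₁ b≤acs = exit-at {P = P} s∈ 0≤c cs∈P acs≰b (interpolate as≤b b≤acs
          λ as≈acs → acs≰b (≤-trans (≤-reflexive (sym as≈acs)) as≤b))

    -- Induction on the half-spaces. If cs violates only the first one, the exit is on its
    -- hyperplane. Otherwise the remaining ones provide an exit point: it is kept if it satisfies
    -- the first inequality, and if not, the first hyperplane is crossed between s and that point.
    exit : ∀ P {s c} → ⟦ P ⟧ s → 0# ≤ c → ¬ ⟦ P ⟧ (c •ᵂ s) → Exit P s
    exit [] _ _ cs∉P = contradiction [] cs∉P
    exit ((a , b) ∷ P) {s} {c} s∈@(_ ∷ s∈P) 0≤c cs∉ with (c •ᵂ s) ∈? P
    ... | yes cs∈P = exit-through {P = P} s∈ 0≤c cs∈P λ acs≤b → cs∉ (acs≤b ∷ cs∈P)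
    ... | no cs∉P with exit P s∈P 0≤c cs∉P
    ...   | E with ⟨ a , Exit.scale E •ᵂ s ⟩ ≤? b
    ...     | yes aτs≤b = record
      { Exit E
      ; point∈  = aτs≤b ∷ Exit.point∈ E
      ; maximal = λ { w (_ ∷ w∈P) → Exit.maximal E w w∈P }
      }
    ...     | no aτs≰b = exit-through {P = P} s∈ (Exit.0≤scale E) (Exit.point∈ E) aτs≰b

  ray-support : ∀ P {s c} → ⟦ P ⟧ s → 0# ≤ c → ¬ ⟦ P ⟧ (c •ᵂ s) → Support P
  ray-support P {s} s∈P 0≤c cs∉P = record { Exit E ; point = Exit.scale E •ᵂ s }
    where E = exit P s∈P 0≤c cs∉P

  -- Without a support no ray through a point of `P` can leave `P`, so `P` is closed under
  -- nonnegative scaling; the factors ½ and 2 then give P = 2P.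
  ≭twice⇒¬¬support : ∀ P → ¬ (⟦ P ⟧ ≐ twice ⟦ P ⟧) → ¬ ¬ Support P
  ≭twice⇒¬¬support P P≭2P ¬support = P≭2P (to , from)
    where
    closed : ∀ {s c} → ⟦ P ⟧ s → 0# ≤ c → ⟦ P ⟧ (c •ᵂ s)
    closed {s} {c} s∈P 0≤c = decidable-stable ((c •ᵂ s) ∈? P) λ cs∉P →
      ¬support (ray-support P s∈P 0≤c cs∉P)
    to : ∀ {w} → ⟦ P ⟧ w → twice ⟦ P ⟧ w
    to {w} w∈P = ½ •ᵂ w , closed w∈P 0≤½ , λ i → sym (2*[½*x]≈x (w i))
    from : ∀ {w} → twice ⟦ P ⟧ w → ⟦ P ⟧ w
    from (s , s∈P , w≈2s) = ⟦⟧-resp P (λ i → sym (w≈2s i)) (closed s∈P 0≤2)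

  module _ {P : Polyhedron} (support : Support P) where
    open Support support

    private
      height : Carrier
      height = ⟨ normal , point ⟩

      dilation⇒≤ : ∀ {m n} → dilation P m (ι n •ᵂ point) → ι n * height ≤ ι m * height
      dilation⇒≤ {m} {n} (s , s∈P , np≈ms) = begin
        ι n * height               ≈⟨ ⟨⟩-•ʳ normal (ι n) point ⟨
        ⟨ normal , ι n •ᵂ point ⟩  ≈⟨ ⟨⟩-congˡ normal np≈ms ⟩
        ⟨ normal , ι m •ᵂ s ⟩      ≈⟨ ⟨⟩-•ʳ normal (ι m) s ⟩
        ι m * ⟨ normal , s ⟩       ≤⟨ *-monoˡ-≤-nonneg (ι-nonneg m) (maximal s s∈P) ⟩
        ι m * height               ∎

    -- The normal is at most m times `height` on mP, but equals n times `height` at the given point;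
    -- for m < n this forces `height` to vanish.
    ∉smaller-dilation : 0# ≤ height → ∀ {m n} → m ℕ.< n → ¬ dilation P m (ι n •ᵂ point)
    ∉smaller-dilation 0≤h {m} {n} m<n np∈mP =
      nonzero (antisym (ι-*-cancel-nonneg m<n 0≤h (dilation⇒≤ {m} {n} np∈mP)) 0≤h)

    ∉larger-dilation : height ≤ 0# → ∀ {m n} → n ℕ.< m → ¬ dilation P m (ι n •ᵂ point)
    ∉larger-dilation h≤0 {m} {n} n<m np∈mP =
      nonzero (antisym h≤0 (ι-*-cancel-nonpos n<m h≤0 (dilation⇒≤ {m} {n} np∈mP)))

  -- Let σ be the supremum of the squared norms on `P`. Doubling a point multiplies its squared norm
  -- by four, so 2P ⊆ P gives σ ≤ σ / 4 and hence σ ≤ 0, contrary to s ≠ 0.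
  bounded⇒≭twice : ∀ P → Bounded ⟦ P ⟧ → ∀ {s} → ⟦ P ⟧ s → ¬ (s ≈ᵂ 0ᵂ) → ¬ (⟦ P ⟧ ≐ twice ⟦ P ⟧)
  bounded⇒≭twice P (r , bound) {s} s∈P s≉0 (_ , 2P⊆P)
    with σ , upper , least ← supremum (λ x → ∃[ w ] ⟦ P ⟧ w × x ≈ ⟨ w , w ⟩) (⟨ s , s ⟩ , s , s∈P , refl)
           (r , λ x (w , w∈P , x≈) → ≤-trans (≤-reflexive x≈) (bound w w∈P)) =
    s≉0 (proj₂ (⟨⟩-definite s) (antisym (≤-trans ss≤σ σ≤0) (proj₁ (⟨⟩-definite s))))
    where
    ss≤σ : ⟨ s , s ⟩ ≤ σ
    ss≤σ = upper ⟨ s , s ⟩ (s , s∈P , refl)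
    0≤σ : 0# ≤ σ
    0≤σ = ≤-trans (proj₁ (⟨⟩-definite s)) ss≤σ
    quadruple≤σ : ∀ w → ⟦ P ⟧ w → 2# * (2# * ⟨ w , w ⟩) ≤ σ
    quadruple≤σ w w∈P = upper _ (2# •ᵂ w , 2P⊆P (w , w∈P , λ _ → refl) , (begin-equality
      2# * (2# * ⟨ w , w ⟩)                  ≈⟨ *-congˡ (⟨⟩-•ʳ w 2# w) ⟨
      2# * ⟨ w , 2# •ᵂ w ⟩                   ≈⟨ *-congˡ (sum-cong-≋ λ i → *-comm (w i) (2# * w i)) ⟩
      2# * ⟨ 2# •ᵂ w , w ⟩                   ≈⟨ ⟨⟩-•ʳ (2# •ᵂ w) 2# w ⟨
      ⟨ 2# •ᵂ w , 2# •ᵂ w ⟩                  ∎))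
    ½*2*x≈x : ∀ x → ½ * (2# * x) ≈ x
    ½*2*x≈x x = trans (solve 3 (λ h t x → h :* (t :* x) := t :* (h :* x)) refl ½ 2# x) (2*[½*x]≈x x)
    σ≤½½σ : σ ≤ ½ * (½ * σ)
    σ≤½½σ = least _ λ x (w , w∈P , x≈ww) → begin
      x                                  ≈⟨ x≈ww ⟩
      ⟨ w , w ⟩                          ≈⟨ ½*2*x≈x _ ⟨
      ½ * (2# * ⟨ w , w ⟩)               ≈⟨ *-congˡ (½*2*x≈x _) ⟨
      ½ * (½ * (2# * (2# * ⟨ w , w ⟩)))  ≤⟨ *-monoˡ-≤-nonneg 0≤½ (*-monoˡ-≤-nonneg 0≤½ (quadruple≤σ w w∈P)) ⟩
      ½ * (½ * σ)                        ∎
    σ≤½σ : σ ≤ ½ * σ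
    σ≤½σ = ≤-trans σ≤½½σ (*-monoˡ-≤-nonneg 0≤½ (begin
      ½ * σ          ≤⟨ x≤x+y _ (*-nonneg 0≤½ 0≤σ) ⟩
      ½ * σ + ½ * σ  ≈⟨ distribʳ σ ½ ½ ⟨
      (½ + ½) * σ    ≈⟨ *-congʳ ½+½≈1 ⟩
      1# * σ         ≈⟨ *-identityˡ σ ⟩
      σ              ∎))
    σ≤0 : σ ≤ 0#
    σ≤0 = +-cancelʳ-≤ σ (begin
      σ + σ            ≤⟨ +-mono-≤ σ≤½σ σ≤½σ ⟩
      ½ * σ + ½ * σ    ≈⟨ distribʳ σ ½ ½ ⟨
      (½ + ½) * σ      ≈⟨ *-congʳ ½+½≈1 ⟩
      1# * σ           ≈⟨ *-identityˡ σ ⟩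
      σ                ≈⟨ +-identityˡ σ ⟨
      0# + σ           ∎)

-- Polynomial arithmetic and division by X, X - 1 and X(X - 1).

module PolynomialProperties (R : CommutativeRing 0ℓ 0ℓ) where
  open CommutativeRing R hiding (zero)
  open Polynomials R
  open SetoidReasoning setoid
  open NaturalCoefficients commutativeSemiring using (solve; _:=_; _:+_; _:*_; con)

  coeff-+ : ∀ p q n → coeff (p +ₚ q) n ≈ coeff p n + coeff q n
  coeff-+ []      q       n       = sym (+-identityˡ _)
  coeff-+ (a ∷ p) []      n       = sym (+-identityʳ _)
  coeff-+ (a ∷ p) (b ∷ q) zero    = refl
  coeff-+ (a ∷ p) (b ∷ q) (suc n) = coeff-+ p q n

  coeff-• : ∀ c p n → coeff (c •ₚ p) n ≈ c * coeff p n
  coeff-• c []      n       = sym (zeroʳ c)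
  coeff-• c (a ∷ p) zero    = refl
  coeff-• c (a ∷ p) (suc n) = coeff-• c p n

  ∷-cong : ∀ {a b p q} → a ≈ b → p ≈ₚ q → (a ∷ p) ≈ₚ (b ∷ q)
  ∷-cong a≈b p≈q zero    = a≈b
  ∷-cong a≈b p≈q (suc n) = p≈q n

  +ₚ-cong : ∀ p p′ q q′ → p ≈ₚ p′ → q ≈ₚ q′ → p +ₚ q ≈ₚ p′ +ₚ q′
  +ₚ-cong p p′ q q′ p≈p′ q≈q′ n =
    trans (coeff-+ p q n) (trans (+-cong (p≈p′ n) (q≈q′ n)) (sym (coeff-+ p′ q′ n)))

  +ₚ-identityʳ : ∀ p → p +ₚ 0ₚ ≈ₚ p
  +ₚ-identityʳ p n = trans (coeff-+ p 0ₚ n) (+-identityʳ _)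

  •ₚ-cong : ∀ c p q → p ≈ₚ q → c •ₚ p ≈ₚ c •ₚ q
  •ₚ-cong c p q p≈q n = trans (coeff-• c p n) (trans (*-congˡ (p≈q n)) (sym (coeff-• c q n)))

  0∷[]≈0ₚ : (0# ∷ []) ≈ₚ 0ₚ
  0∷[]≈0ₚ zero    = refl
  0∷[]≈0ₚ (suc n) = refl

  *ₚ-congˡ : ∀ r {p q} → p ≈ₚ q → r *ₚ p ≈ₚ r *ₚ q
  *ₚ-congˡ []      p≈q n = refl
  *ₚ-congˡ (a ∷ r) {p} {q} p≈q =
    +ₚ-cong (a •ₚ p) (a •ₚ q) (0# ∷ r *ₚ p) (0# ∷ r *ₚ q) (•ₚ-cong a p q p≈q) (∷-cong refl (*ₚ-congˡ r p≈q))

  -- Prepending a zero is multiplication by X, so this is r(Xq) = X(rq).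
  *ₚ-shiftʳ : ∀ r q → r *ₚ (0# ∷ q) ≈ₚ 0# ∷ r *ₚ q
  *ₚ-shiftʳ []      q n       = sym (0∷[]≈0ₚ n)
  *ₚ-shiftʳ (a ∷ r) q zero    = trans (+-identityʳ _) (zeroʳ a)
  *ₚ-shiftʳ (a ∷ r) q (suc n) = +ₚ-cong (a •ₚ q) (a •ₚ q) (r *ₚ (0# ∷ q)) (0# ∷ r *ₚ q) (λ _ → refl) (*ₚ-shiftʳ r q) n

  *ₚ-identityʳ : ∀ r → r *ₚ 1ₚ ≈ₚ r
  *ₚ-identityʳ []      n       = refl
  *ₚ-identityʳ (a ∷ r) zero    = trans (+-identityʳ _) (*-identityʳ a)
  *ₚ-identityʳ (a ∷ r) (suc n) = *ₚ-identityʳ r n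

  *ₚ-identityˡ : ∀ p → 1ₚ *ₚ p ≈ₚ p
  *ₚ-identityˡ p n = begin
    coeff (1# •ₚ p +ₚ (0# ∷ [])) n            ≈⟨ coeff-+ (1# •ₚ p) (0# ∷ []) n ⟩
    coeff (1# •ₚ p) n + coeff (0# ∷ []) n     ≈⟨ +-cong (coeff-• 1# p n) (0∷[]≈0ₚ n) ⟩
    1# * coeff p n + 0#                       ≈⟨ +-identityʳ _ ⟩
    1# * coeff p n                            ≈⟨ *-identityˡ _ ⟩
    coeff p n                                 ∎

  X*p≈0∷p : ∀ p → X *ₚ p ≈ₚ 0# ∷ p
  X*p≈0∷p p n = begin
    coeff (0# •ₚ p +ₚ (0# ∷ 1ₚ *ₚ p)) n               ≈⟨ coeff-+ (0# •ₚ p) (0# ∷ 1ₚ *ₚ p) n ⟩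
    coeff (0# •ₚ p) n + coeff (0# ∷ 1ₚ *ₚ p) n        ≈⟨ +-cong (coeff-• 0# p n) (∷-cong refl (*ₚ-identityˡ p) n) ⟩
    0# * coeff p n + coeff (0# ∷ p) n                 ≈⟨ +-congʳ (zeroˡ _) ⟩
    0# + coeff (0# ∷ p) n                             ≈⟨ +-identityˡ _ ⟩
    coeff (0# ∷ p) n                                  ∎

  p*X≈0∷p : ∀ p → p *ₚ X ≈ₚ 0# ∷ p
  p*X≈0∷p p n = trans (*ₚ-shiftʳ p 1ₚ n) (∷-cong refl (*ₚ-identityʳ p) n)

  -- Rewrites a list cell in terms of the algebra operations, so that a homomorphism can be computed
  -- by recursion on the coefficients.
  ∷≈•1+X* : ∀ a p → (a ∷ p) ≈ₚ a •ₚ 1ₚ +ₚ X *ₚ p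
  ∷≈•1+X* a p n = sym (trans (+ₚ-cong (a •ₚ 1ₚ) (a •ₚ 1ₚ) (X *ₚ p) (0# ∷ p) (λ _ → refl) (X*p≈0∷p p) n) (go n))
    where
    go : a •ₚ 1ₚ +ₚ (0# ∷ p) ≈ₚ (a ∷ p)
    go zero    = trans (+-identityʳ _) (*-identityʳ a)
    go (suc n) = refl

  p*0≈0 : ∀ p → p *ₚ 0ₚ ≈ₚ 0ₚ
  p*0≈0 []      n       = refl
  p*0≈0 (a ∷ p) zero    = refl
  p*0≈0 (a ∷ p) (suc n) = p*0≈0 p n

  X-1 : Poly
  X-1 = X +ₚ -ₚ 1ₚ

  divide-X : ∀ p → ∃[ r ] ∃[ a ] p ≈ₚ r *ₚ X +ₚ (a ∷ [])
  divide-X []      = [] , 0# , λ n → sym (0∷[]≈0ₚ n)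
  divide-X (a ∷ p) = p , a , λ n →
    sym (trans (+ₚ-cong (p *ₚ X) (0# ∷ p) (a ∷ []) (a ∷ []) (p*X≈0∷p p) (λ _ → refl) n)
        (∷-cong {p = p +ₚ 0ₚ} (+-identityˡ a) (+ₚ-identityʳ p) n))

  -- Horner's rule: the quotient of p by X − 1 extends the quotient of the tail
  -- of p by its remainder.
  divide-X-1 : ∀ p → ∃[ r ] ∃[ a ] p ≈ₚ r *ₚ X-1 +ₚ (a ∷ [])
  divide-X-1 []      = [] , 0# , λ n → sym (0∷[]≈0ₚ n)
  divide-X-1 (a ∷ p) with r , b , p≈ ← divide-X-1 p = b ∷ r , a + b , go
    where
    -- The coefficient 0# + - 1# of X-1 is kept opaque, as m.
    expand : ∀ m → m + 1# ≈ 0# → a ≈ b * m + 0# + (a + b)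
    expand m m+1≈0 = sym (begin
      b * m + 0# + (a + b)  ≈⟨ solve 3 (λ a b m →
        b :* m :+ con 0 :+ (a :+ b) := a :+ b :* (m :+ con 1)) refl a b m ⟩
      a + b * (m + 1#)      ≈⟨ +-congˡ (*-congˡ m+1≈0) ⟩
      a + b * 0#            ≈⟨ +-congˡ (zeroʳ b) ⟩
      a + 0#                ≈⟨ +-identityʳ a ⟩
      a                     ∎)
    tail : (p +ₚ 0ₚ) ≈ₚ ((b * 1# ∷ []) +ₚ r *ₚ X-1) +ₚ 0ₚ
    tail n = begin
      coeff (p +ₚ 0ₚ) n                              ≈⟨ +ₚ-identityʳ p n ⟩
      coeff p n                                      ≈⟨ p≈ n ⟩
      coeff (r *ₚ X-1 +ₚ (b ∷ [])) n                 ≈⟨ coeff-+ (r *ₚ X-1) (b ∷ []) n ⟩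
      coeff (r *ₚ X-1) n + coeff (b ∷ []) n          ≈⟨ +-comm _ _ ⟩
      coeff (b ∷ []) n + coeff (r *ₚ X-1) n          ≈⟨ +-congʳ (∷-cong {p = []} (sym (*-identityʳ b)) (λ _ → refl) n) ⟩
      coeff (b * 1# ∷ []) n + coeff (r *ₚ X-1) n     ≈⟨ coeff-+ (b * 1# ∷ []) (r *ₚ X-1) n ⟨
      coeff ((b * 1# ∷ []) +ₚ r *ₚ X-1) n            ≈⟨ +ₚ-identityʳ ((b * 1# ∷ []) +ₚ r *ₚ X-1) n ⟨
      coeff (((b * 1# ∷ []) +ₚ r *ₚ X-1) +ₚ 0ₚ) n    ∎
    go : (a ∷ p) ≈ₚ (b ∷ r) *ₚ X-1 +ₚ (a + b ∷ [])
    go zero    = expand (0# + - 1#) (trans (+-congʳ (+-identityˡ (- 1#))) (-‿inverseˡ 1#))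
    go (suc n) = trans (sym (+ₚ-identityʳ p n)) (tail n)

  X*[X-1] : Poly
  X*[X-1] = X *ₚ X-1

  -- Dividing only the tail by X - 1 suffices: a + X(r(X - 1) + b) = rX(X - 1) + (a + bX).
  divide-X*[X-1] : ∀ p → ∃[ r ] ∃[ a ] ∃[ b ] p ≈ₚ r *ₚ X*[X-1] +ₚ (a ∷ b ∷ [])
  divide-X*[X-1] []      = [] , 0# , 0# , λ { zero → refl ; (suc n) → sym (0∷[]≈0ₚ n) }
  divide-X*[X-1] (a ∷ p) with r , b , p≈ ← divide-X-1 p = r , a , b , λ n → sym (begin
    coeff (r *ₚ X*[X-1] +ₚ (a ∷ b ∷ [])) n      ≈⟨ +ₚ-cong (r *ₚ X*[X-1]) (0# ∷ r *ₚ X-1) (a ∷ b ∷ []) (a ∷ b ∷ []) r*X*[X-1]≈ (λ _ → refl) n ⟩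
    coeff (0# + a ∷ r *ₚ X-1 +ₚ (b ∷ [])) n     ≈⟨ ∷-cong (+-identityˡ a) (λ n → sym (p≈ n)) n ⟩
    coeff (a ∷ p) n                             ∎)
    where
    r*X*[X-1]≈ : r *ₚ X*[X-1] ≈ₚ 0# ∷ r *ₚ X-1
    r*X*[X-1]≈ n = trans (*ₚ-congˡ r (X*p≈0∷p X-1) n) (*ₚ-shiftʳ r X-1 n)

-- Stability of equality, and values of indicator functions.

module Kernel (ℝ : RealNumbers) (d : ℕ) (𝓐 : Polyhedra.PolyhedraAlgebra ℝ d)
              (S : Polyhedra.Polyhedron ℝ d) where
  private
    module R = RealNumbers ℝ
  open OrderedField ℝ using (ι; total)
  open ComplexNumbers ℝ using (ℂ; ℂ-commutativeRing)
  open Polyhedra ℝ d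
  open Geometry ℝ d
  open Subalgebra 𝓐 S
  open PolyhedraAlgebra 𝓐
  open PolynomialProperties ℂ-commutativeRing
  open CommutativeRing ℂ-commutativeRing hiding (zero; -_)
  open SetoidReasoning setoid

  private
    𝕄 : CommutativeRing 0ℓ 0ℓ
    𝕄 = record { isCommutativeRing = isCommutativeRing-M }
    module 𝕄 = CommutativeRing 𝕄

  ≈-stable : ∀ {z w : ℂ} → ¬ ¬ (z ≈ w) → z ≈ w
  ≈-stable {a , b} {c , d} = decidable-stable ((a R.≟ c) ×-dec (b R.≟ d))

  ≈ₚ-stable : ∀ p q → ¬ ¬ (p ≈ₚ q) → p ≈ₚ q
  ≈ₚ-stable p q ¬¬eq n = ≈-stable λ ¬eq → ¬¬eq λ eq → ¬eq (eq n)

  ≈ᴹ-stable : ∀ f g → ¬ ¬ (f ≈ᴹ g) → f ≈ᴹ g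
  ≈ᴹ-stable f g ¬¬eq w = ≈-stable λ ¬eq → ¬¬eq λ eq → ¬eq (eq w)

  indicator-∈ : ∀ P {w} → ⟦ P ⟧ w → indicator P w ≡ 1#
  indicator-∈ P {w} w∈ = ≡.cong (λ b → if b then 1# else 0#) (dec-true (w ∈? P) w∈)

  indicator-∉ : ∀ P {w} → ¬ ⟦ P ⟧ w → indicator P w ≡ 0#
  indicator-∉ P {w} w∉ = ≡.cong (λ b → if b then 1# else 0#) (dec-false (w ∈? P) w∉)

  *-indicator-∈ : ∀ a P {w} → ⟦ P ⟧ w → a * indicator P w ≈ a
  *-indicator-∈ a P w∈ = trans (*-congˡ (reflexive (indicator-∈ P w∈))) (*-identityʳ a)

  *-indicator-∉ : ∀ a P {w} → ¬ ⟦ P ⟧ w → a * indicator P w ≈ 0#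
  *-indicator-∉ a P w∉ = trans (*-congˡ (reflexive (indicator-∉ P w∉))) (zeroʳ a)

  [∅]≈0 : ∀ P → ⟦ P ⟧ ≐ ∅ → [ P ] ≈ᴹ 0ᴹ
  [∅]≈0 P (P⊆∅ , _) w = reflexive (indicator-∉ P P⊆∅)

  1ᴹ≈[origin] : 1ᴹ ≈ᴹ [ origin ]
  1ᴹ≈[origin] = 1ᴹ≈[0] origin origin≐｛0｝

  0ᵂ∈origin : ⟦ origin ⟧ 0ᵂ
  0ᵂ∈origin = proj₂ origin≐｛0｝ λ _ → R.refl

  -- The unit is the indicator of {0}, so evaluation at the origin recovers `a`.
  •1ᴹ-injective : ∀ a → a •ᴹ 1ᴹ ≈ᴹ 0ᴹ → a ≈ 0#
  •1ᴹ-injective a a•1≈0 = begin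
    a                         ≈⟨ *-indicator-∈ a origin 0ᵂ∈origin ⟨
    a * indicator origin 0ᵂ   ≈⟨ *-congˡ (1ᴹ≈[origin] 0ᵂ) ⟨
    a * proj₁ 1ᴹ 0ᵂ           ≈⟨ a•1≈0 0ᵂ ⟩
    0#                        ∎

  x≈0∧x+y≈0⇒y≈0 : ∀ {x y} → x ≈ 0# → x + y ≈ 0# → y ≈ 0#
  x≈0∧x+y≈0⇒y≈0 x≈0 x+y≈0 = trans (sym (trans (+-congʳ x≈0) (+-identityˡ _))) x+y≈0

  y≈0∧x+y≈0⇒x≈0 : ∀ {x y} → y ≈ 0# → x + y ≈ 0# → x ≈ 0#
  y≈0∧x+y≈0⇒x≈0 y≈0 x+y≈0 = trans (sym (trans (+-congˡ y≈0) (+-identityʳ _))) x+y≈0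

  -- Multiplication by `[ S ]`, and combinations of the indicators of the multiples of `S`.

  ·-•-assoc : ∀ c f g → f · (c •ᴹ g) ≈ᴹ c •ᴹ (f · g)
  ·-•-assoc c f g w = begin
    proj₁ (f · (c •ᴹ g)) w  ≈⟨ 𝕄.*-comm f (c •ᴹ g) w ⟩
    proj₁ ((c •ᴹ g) · f) w  ≈⟨ •-·-assoc c g f w ⟩
    c * proj₁ (g · f) w     ≈⟨ *-congˡ (𝕄.*-comm g f w) ⟩
    c * proj₁ (f · g) w     ∎

  [S]·[nS] : Satisfiable ⟦ S ⟧ → ∀ n → [ S ] · [ multiple S n ] ≈ᴹ [ multiple S (suc n) ]
  [S]·[nS] sat@(s , s∈S) n = indicator-· S (multiple S n) (multiple S (suc n)) sat
    (_ , proj₂ (multiple≐dilation S n sat) (s , s∈S , λ _ → R.refl))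
    (multiple-suc S n sat)

  -- For coefficients aₖ this is the sum of aₖ[(n + k)S]. The offset `n` turns multiplication by
  -- `[ S ]` into an increment.
  combination : Poly → ℕ → M
  combination []      n = 0ᴹ
  combination (a ∷ p) n = a •ᴹ [ multiple S n ] +ᴹ combination p (suc n)

  [S]·combination : Satisfiable ⟦ S ⟧ → ∀ p n → [ S ] · combination p n ≈ᴹ combination p (suc n)
  [S]·combination sat []      n = 𝕄.zeroʳ [ S ]
  [S]·combination sat (a ∷ p) n w = begin
    proj₁ ([ S ] · (a •ᴹ [ multiple S n ] +ᴹ combination p (suc n))) w
      ≈⟨ 𝕄.distribˡ [ S ] (a •ᴹ [ multiple S n ]) (combination p (suc n)) w ⟩
    proj₁ ([ S ] · (a •ᴹ [ multiple S n ])) w + proj₁ ([ S ] · combination p (suc n)) w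
      ≈⟨ +-cong (·-•-assoc a [ S ] [ multiple S n ] w) ([S]·combination sat p (suc n) w) ⟩
    a * proj₁ ([ S ] · [ multiple S n ]) w + proj₁ (combination p (suc (suc n))) w
      ≈⟨ +-congʳ (*-congˡ ([S]·[nS] sat n w)) ⟩
    a * indicator (multiple S (suc n)) w + proj₁ (combination p (suc (suc n))) w  ∎

  -- The zero polynomial may also be given by a nonempty list of zeros, hence the induction.
  combination-≈0ₚ : ∀ p n → p ≈ₚ 0ₚ → combination p n ≈ᴹ 0ᴹ
  combination-≈0ₚ []      n p≈0 w = refl
  combination-≈0ₚ (a ∷ p) n p≈0 w = begin
    a * indicator (multiple S n) w + proj₁ (combination p (suc n)) w
      ≈⟨ +-cong (*-congʳ (p≈0 zero)) (combination-≈0ₚ p (suc n) (λ m → p≈0 (suc m)) w) ⟩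
    0# * indicator (multiple S n) w + 0#  ≈⟨ +-identityʳ _ ⟩
    0# * indicator (multiple S n) w       ≈⟨ zeroˡ _ ⟩
    0#                                    ∎

  -- Linear independence of the indicators of the multiples of `S`.

  module _ (support : Support S) where
    open Support support

    private
      sat : Satisfiable ⟦ S ⟧
      sat = point , point∈

      vertex : ℕ → W
      vertex n = ι n •ᵂ point

      vertex∈ : ∀ n → ⟦ multiple S n ⟧ (vertex n)
      vertex∈ n = proj₂ (multiple≐dilation S n sat) (point , point∈ , λ _ → R.refl)

      ∉dilation⇒∉multiple : ∀ m {w} → ¬ dilation S m w → ¬ ⟦ multiple S m ⟧ w
      ∉dilation⇒∉multiple m w∉ w∈ = w∉ (proj₁ (multiple≐dilation S m sat) w∈)

    -- A triangular system, solved in an order that depends on the sign of the height. Only the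
    -- vertices from `n` on are evaluated, which is what the recursion on the tail can supply.
    combination-injective : ∀ p n → (∀ m → n ℕ.≤ m → proj₁ (combination p n) (vertex m) ≈ 0#) → p ≈ₚ 0ₚ
    combination-injective with total R.0# ⟨ normal , point ⟩
    ... | inj₁ 0≤h = go
      where
      go : ∀ p n → (∀ m → n ℕ.≤ m → proj₁ (combination p n) (vertex m) ≈ 0#) → p ≈ₚ 0ₚ
      go []      n _  _ = refl
      go (a ∷ p) n eq = λ { zero → a≈0 ; (suc m) → p≈0 m }
        where
        -- Later vertices avoid nS, so the leading term drops out there and the tail vanishes first.
        p≈0 : p ≈ₚ 0ₚ
        p≈0 = go p (suc n) λ m n<m → x≈0∧x+y≈0⇒y≈0
          (*-indicator-∉ a (multiple S n) (∉dilation⇒∉multiple n (∉smaller-dilation support 0≤h n<m)))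
          (eq m (ℕ.<⇒≤ n<m))
        a≈0 : a ≈ 0#
        a≈0 = trans (sym (*-indicator-∈ a (multiple S n) (vertex∈ n)))
          (y≈0∧x+y≈0⇒x≈0 (combination-≈0ₚ p (suc n) p≈0 (vertex n)) (eq n ℕ.≤-refl))
    ... | inj₂ h≤0 = go
      where
      -- Vertex n lies in none of the larger multiples, so evaluation there isolates the leading
      -- coefficient, which therefore vanishes first.
      vanish : ∀ p {n k} → n ℕ.< k → proj₁ (combination p k) (vertex n) ≈ 0#
      vanish []      n<k = refl
      vanish (a ∷ p) {n} {k} n<k = trans (+-cong
        (*-indicator-∉ a (multiple S k) (∉dilation⇒∉multiple k (∉larger-dilation support h≤0 n<k)))
        (vanish p (ℕ.m<n⇒m<1+n n<k))) (+-identityˡ 0#)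
      go : ∀ p n → (∀ m → n ℕ.≤ m → proj₁ (combination p n) (vertex m) ≈ 0#) → p ≈ₚ 0ₚ
      go []      n _  _ = refl
      go (a ∷ p) n eq = λ { zero → a≈0 ; (suc m) → p≈0 m }
        where
        a≈0 : a ≈ 0#
        a≈0 = trans (sym (*-indicator-∈ a (multiple S n) (vertex∈ n)))
          (y≈0∧x+y≈0⇒x≈0 (vanish p ℕ.≤-refl) (eq n ℕ.≤-refl))
        p≈0 : p ≈ₚ 0ₚ
        p≈0 = go p (suc n) λ m n<m → x≈0∧x+y≈0⇒y≈0
          (trans (*-congʳ a≈0) (zeroˡ _)) (eq m (ℕ.<⇒≤ n<m))

  ≭∅⇒¬¬satisfiable : ¬ (⟦ S ⟧ ≐ ∅) → ¬ ¬ Satisfiable ⟦ S ⟧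
  ≭∅⇒¬¬satisfiable S≭∅ ¬sat = S≭∅ ((λ s∈S → ¬sat (_ , s∈S)) , λ ())

  -- Without such a point `S` is contained in {0}, and being nonempty it would equal {0}.
  ¬¬nonzero-point : ¬ (⟦ S ⟧ ≐ ∅) → ¬ (⟦ S ⟧ ≐ ｛0｝) → ¬ ¬ (∃[ s ] ⟦ S ⟧ s × ¬ (s ≈ᵂ 0ᵂ))
  ¬¬nonzero-point S≭∅ S≭0 none = ≭∅⇒¬¬satisfiable S≭∅ λ (s , s∈S) →
    S≭0 (S⊆0 , λ {w} w≈0 → ⟦⟧-resp S (λ i → R.trans (S⊆0 s∈S i) (R.sym (w≈0 i))) s∈S)
    where
    S⊆0 : ∀ {s} → ⟦ S ⟧ s → s ≈ᵂ 0ᵂ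
    S⊆0 {s} s∈S = ≈0ᵂ-stable s λ s≉0 → none (s , s∈S , s≉0)

  -- Computing the homomorphism, and a criterion for its kernel.

  module _ (φ : Poly → M⟨S⟩) (φ-hom : IsAlgebraHomomorphism φ) (φX≈S : φ X ≈ˢ gen) where
    open IsAlgebraHomomorphism φ-hom
    open RingMorphisms rawRing-Poly rawRing-M⟨S⟩
    open IsRingHomomorphism isRingHomomorphism

    private
      ψ : Poly → M
      ψ p = proj₁ (φ p)

      I : Pred Poly 0ℓ
      I = kernel φ

    ψ-∷ : ∀ a p → ψ (a ∷ p) ≈ᴹ a •ᴹ 1ᴹ +ᴹ [ S ] · ψ p
    ψ-∷ a p w = begin
      proj₁ (ψ (a ∷ p)) w                            ≈⟨ ⟦⟧-cong (∷≈•1+X* a p) w ⟩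
      proj₁ (ψ (a •ₚ 1ₚ +ₚ X *ₚ p)) w                ≈⟨ +-homo (a •ₚ 1ₚ) (X *ₚ p) w ⟩
      proj₁ (ψ (a •ₚ 1ₚ)) w + proj₁ (ψ (X *ₚ p)) w   ≈⟨ +-cong (•-homo a 1ₚ w) (*-homo X p w) ⟩
      a * proj₁ (ψ 1ₚ) w + proj₁ (ψ X · ψ p) w       ≈⟨ +-cong (*-congˡ (1#-homo w)) (𝕄.*-congʳ {ψ p} {ψ X} {[ S ]} φX≈S w) ⟩
      a * proj₁ 1ᴹ w + proj₁ ([ S ] · ψ p) w         ∎

    ψ-const : ∀ a → ψ (a ∷ []) ≈ᴹ a •ᴹ 1ᴹ
    ψ-const a w = begin
      proj₁ (ψ (a ∷ [])) w                        ≈⟨ ψ-∷ a [] w ⟩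
      a * proj₁ 1ᴹ w + proj₁ ([ S ] · ψ []) w     ≈⟨ +-congˡ (𝕄.*-congˡ {[ S ]} {ψ []} {0ᴹ} 0#-homo w) ⟩
      a * proj₁ 1ᴹ w + proj₁ ([ S ] · 0ᴹ) w       ≈⟨ +-congˡ (𝕄.zeroʳ [ S ] w) ⟩
      a * proj₁ 1ᴹ w + 0#                         ≈⟨ +-identityʳ _ ⟩
      a * proj₁ 1ᴹ w                              ∎

    ψ-linear : ∀ a b → ψ (a ∷ b ∷ []) ≈ᴹ a •ᴹ 1ᴹ +ᴹ b •ᴹ [ S ]
    ψ-linear a b w = begin
      proj₁ (ψ (a ∷ b ∷ [])) w                          ≈⟨ ψ-∷ a (b ∷ []) w ⟩
      a * proj₁ 1ᴹ w + proj₁ ([ S ] · ψ (b ∷ [])) w     ≈⟨ +-congˡ (𝕄.*-congˡ {[ S ]} {ψ (b ∷ [])} {b •ᴹ 1ᴹ} (ψ-const b) w) ⟩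
      a * proj₁ 1ᴹ w + proj₁ ([ S ] · (b •ᴹ 1ᴹ)) w      ≈⟨ +-congˡ (·-•-assoc b [ S ] 1ᴹ w) ⟩
      a * proj₁ 1ᴹ w + b * proj₁ ([ S ] · 1ᴹ) w         ≈⟨ +-congˡ (*-congˡ (𝕄.*-identityʳ [ S ] w)) ⟩
      a * proj₁ 1ᴹ w + b * indicator S w                ∎

    -- Horner's scheme: multiplying by `[ S ]` raises the offset of the tail to one, and the
    -- constant term multiplies the unit, which is the indicator of 0S = {0}.
    ψ≈combination : Satisfiable ⟦ S ⟧ → ∀ p → ψ p ≈ᴹ combination p 0
    ψ≈combination sat []      = 0#-homo
    ψ≈combination sat (a ∷ p) w = begin
      proj₁ (ψ (a ∷ p)) w                                    ≈⟨ ψ-∷ a p w ⟩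
      a * proj₁ 1ᴹ w + proj₁ ([ S ] · ψ p) w                 ≈⟨ +-cong (*-congˡ (1ᴹ≈[origin] w))
        (𝕄.*-congˡ {[ S ]} {ψ p} {combination p 0} (ψ≈combination sat p) w) ⟩
      a * indicator origin w + proj₁ ([ S ] · combination p 0) w ≈⟨ +-congˡ ([S]·combination sat p 0 w) ⟩
      a * indicator origin w + proj₁ (combination p 1) w     ∎

    ψ-*-kernel : ∀ r q → ψ q ≈ᴹ 0ᴹ → ψ (r *ₚ q) ≈ᴹ 0ᴹ
    ψ-*-kernel r q ψq≈0 w = begin
      proj₁ (ψ (r *ₚ q)) w     ≈⟨ *-homo r q w ⟩
      proj₁ (ψ r · ψ q) w      ≈⟨ 𝕄.*-congˡ {ψ r} {ψ q} {0ᴹ} ψq≈0 w ⟩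
      proj₁ (ψ r · 0ᴹ) w       ≈⟨ 𝕄.zeroʳ (ψ r) w ⟩
      0#                       ∎

    -- The pattern common to all cases: if `q` is in the kernel, then p and its remainder modulo `q`
    -- have the same image, so it suffices that no nonzero remainder is in the kernel.
    kernel≐principalIdeal : ∀ q → ψ q ≈ᴹ 0ᴹ →
      (∀ p → ∃[ r ] ∃[ s ] p ≈ₚ r *ₚ q +ₚ s × (ψ s ≈ᴹ 0ᴹ → s ≈ₚ 0ₚ)) →
      I ≐ principalIdeal q
    kernel≐principalIdeal q ψq≈0 divide = to , from
      where
      to : ∀ {p} → I p → principalIdeal q p
      to {p} ψp≈0 with r , s , p≈rq+s , s-inj ← divide p = r , λ n → begin
        coeff p n                           ≈⟨ p≈rq+s n ⟩
        coeff (r *ₚ q +ₚ s) n               ≈⟨ coeff-+ (r *ₚ q) s n ⟩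
        coeff (r *ₚ q) n + coeff s n        ≈⟨ +-congˡ (s-inj ψs≈0 n) ⟩
        coeff (r *ₚ q) n + 0#               ≈⟨ +-identityʳ _ ⟩
        coeff (r *ₚ q) n                    ∎
        where
        ψs≈0 : ψ s ≈ᴹ 0ᴹ
        ψs≈0 w = x≈0∧x+y≈0⇒y≈0 (ψ-*-kernel r q ψq≈0 w)
          (trans (sym (+-homo (r *ₚ q) s w)) (trans (sym (⟦⟧-cong p≈rq+s w)) (ψp≈0 w)))
      from : ∀ {p} → principalIdeal q p → I p
      from (r , p≈rq) w = trans (⟦⟧-cong p≈rq w) (ψ-*-kernel r q ψq≈0 w)

    -- The kernel in each of the four cases.

    ψ-const-injective : ∀ a → ψ (a ∷ []) ≈ᴹ 0ᴹ → (a ∷ []) ≈ₚ 0ₚ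
    ψ-const-injective a ψa≈0 zero    = •1ᴹ-injective a λ w → trans (sym (ψ-const a w)) (ψa≈0 w)
    ψ-const-injective a ψa≈0 (suc n) = refl

    ψ[X-1] : ψ X-1 ≈ᴹ [ S ] +ᴹ (-ᴹ 1ᴹ)
    ψ[X-1] w = begin
      proj₁ (ψ X-1) w                           ≈⟨ +-homo X (-ₚ 1ₚ) w ⟩
      proj₁ (ψ X) w + proj₁ (ψ (-ₚ 1ₚ)) w       ≈⟨ +-cong (φX≈S w) (-‿homo 1ₚ w) ⟩
      indicator S w + proj₁ (-ᴹ ψ 1ₚ) w         ≈⟨ +-congˡ (𝕄.-‿cong {ψ 1ₚ} {1ᴹ} 1#-homo w) ⟩
      indicator S w + proj₁ (-ᴹ 1ᴹ) w           ∎

    kernel-∅ : ⟦ S ⟧ ≐ ∅ → I ≐ principalIdeal X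
    kernel-∅ S≐∅ = kernel≐principalIdeal X
      (λ w → trans (φX≈S w) ([∅]≈0 S S≐∅ w))
      λ p → let r , a , p≈ = divide-X p in r , a ∷ [] , p≈ , ψ-const-injective a

    kernel-｛0｝ : ⟦ S ⟧ ≐ ｛0｝ → I ≐ principalIdeal X-1
    kernel-｛0｝ S≐0 = kernel≐principalIdeal X-1
      (λ w → trans (ψ[X-1] w) (trans (+-congʳ (sym (1ᴹ≈[0] S S≐0 w))) (𝕄.-‿inverseʳ 1ᴹ w)))
      λ p → let r , a , p≈ = divide-X-1 p in r , a ∷ [] , p≈ , ψ-const-injective a

    -- The image of X(X - 1) is [S + S] - [S] = 0, and a remainder a + bX is determined by its
    -- values at the origin and at a nonzero point of `S`.
    kernel-cone : ¬ (⟦ S ⟧ ≐ ∅) → ¬ (⟦ S ⟧ ≐ ｛0｝) → ⟦ S ⟧ ≐ twice ⟦ S ⟧ →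
                  I ≐ principalIdeal X*[X-1]
    kernel-cone S≭∅ S≭0 S≐2S = kernel≐principalIdeal X*[X-1]
      (≈ᴹ-stable (ψ X*[X-1]) 0ᴹ λ ≉0 → ≭∅⇒¬¬satisfiable S≭∅ λ sat → ≉0 (ψ≈0 sat))
      λ p → let r , a , b , p≈ = divide-X*[X-1] p in r , a ∷ b ∷ [] , p≈ , λ ψs≈0 →
        ≈ₚ-stable (a ∷ b ∷ []) 0ₚ λ ≉0 → ¬¬nonzero-point S≭∅ S≭0 λ (s , s∈S , s≉0) →
          ≉0 (linear-injective a b ψs≈0 s∈S s≉0)
      where
      ψ≈0 : Satisfiable ⟦ S ⟧ → ψ X*[X-1] ≈ᴹ 0ᴹ
      ψ≈0 sat w = begin
        proj₁ (ψ X*[X-1]) w                                     ≈⟨ *-homo X X-1 w ⟩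
        proj₁ (ψ X · ψ X-1) w                                   ≈⟨ 𝕄.*-cong {ψ X} {[ S ]} {ψ X-1} {[ S ] +ᴹ (-ᴹ 1ᴹ)} φX≈S ψ[X-1] w ⟩
        proj₁ ([ S ] · ([ S ] +ᴹ (-ᴹ 1ᴹ))) w                    ≈⟨ 𝕄.distribˡ [ S ] [ S ] (-ᴹ 1ᴹ) w ⟩
        proj₁ ([ S ] · [ S ]) w + proj₁ ([ S ] · (-ᴹ 1ᴹ)) w     ≈⟨ +-cong (indicator-· S S S sat sat (⊕-idem S S≐2S) w)
          (trans (·-•-assoc _ [ S ] 1ᴹ w) (𝕄.-‿cong {[ S ] · 1ᴹ} {[ S ]} (𝕄.*-identityʳ [ S ]) w)) ⟩
        indicator S w + proj₁ (-ᴹ [ S ]) w                      ≈⟨ 𝕄.-‿inverseʳ [ S ] w ⟩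
        0#                                                      ∎
      linear-injective : ∀ a b → ψ (a ∷ b ∷ []) ≈ᴹ 0ᴹ → ∀ {s} → ⟦ S ⟧ s → ¬ (s ≈ᵂ 0ᵂ) → (a ∷ b ∷ []) ≈ₚ 0ₚ
      linear-injective a b ψs≈0 {s} s∈S s≉0 =
        λ { zero → a≈0 ; (suc zero) → b≈0 ; (suc (suc n)) → refl }
        where
        value : ∀ w → a * indicator origin w + b * indicator S w ≈ 0#
        value w = trans (+-congʳ (*-congˡ (sym (1ᴹ≈[origin] w)))) (trans (sym (ψ-linear a b w)) (ψs≈0 w))
        -- At s ≠ 0 the indicator of {0} vanishes and only b remains; the value at the origin then
        -- gives a.
        b≈0 : b ≈ 0#
        b≈0 = trans (sym (*-indicator-∈ b S s∈S)) (x≈0∧x+y≈0⇒y≈0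
          (*-indicator-∉ a origin λ s∈0 → s≉0 (proj₁ origin≐｛0｝ s∈0)) (value s))
        a≈0 : a ≈ 0#
        a≈0 = trans (sym (*-indicator-∈ a origin 0ᵂ∈origin)) (y≈0∧x+y≈0⇒x≈0
          (trans (*-congʳ b≈0) (zeroˡ _)) (value 0ᵂ))

    kernel-≭twice : ¬ (⟦ S ⟧ ≐ twice ⟦ S ⟧) → I ≐ principalIdeal 0ₚ
    kernel-≭twice S≭2S = kernel≐principalIdeal 0ₚ 0#-homo
      -- Modulo the zero polynomial each p is its own remainder, so the criterion amounts to
      -- injectivity.
      λ p → 0ₚ , p , (λ _ → refl) , λ ψp≈0 →
        ≈ₚ-stable p 0ₚ λ ≉0 → ≭twice⇒¬¬support S S≭2S λ support →
          ≉0 (combination-injective support p 0 λ m _ →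
            let open Support support in
            trans (sym (ψ≈combination (point , point∈) p (ι m •ᵂ point))) (ψp≈0 (ι m •ᵂ point)))

-- The whole space as a cone, and assembly of the cases.

module _ (ℝ : RealNumbers) (d : ℕ) (d≥1 : d ≥ 1) where
  open RealNumbers ℝ using (1#; 0≉1; sym)
  open OrderedField ℝ using (½; 2*[½*x]≈x)
  open Polyhedra ℝ d

  whole-space-cone : ∀ P → ⟦ P ⟧ ≐ U → ¬ (⟦ P ⟧ ≐ ∅) × ¬ (⟦ P ⟧ ≐ ｛0｝) × ⟦ P ⟧ ≐ twice ⟦ P ⟧
  whole-space-cone P (_ , U⊆P) =
    (λ (P⊆∅ , _) → P⊆∅ (U⊆P {0ᵂ} _)) ,
    -- The all-ones vector is nonzero because d ≥ 1 provides a coordinate.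
    (λ (P⊆0 , _) → 0≉1 (sym (P⊆0 (U⊆P {λ _ → 1#} _) (Fin.fromℕ< d≥1)))) ,
    (λ {w} _ → ½ •ᵂ w , U⊆P _ , λ i → sym (2*[½*x]≈x (w i))) ,
    (λ _ → U⊆P _)

mainTheorem1 : (ℝ : RealNumbers) (d : ℕ) → d ≥ 1 →
    let open Polyhedra ℝ d in
    (𝓐 : PolyhedraAlgebra) (S : Polyhedron) →
    let open Subalgebra 𝓐 S in
    (φ : Poly → M⟨S⟩) →
    IsAlgebraHomomorphism φ →
    φ X ≈ˢ gen →
    Surjective _≈ₚ_ _≈ˢ_ φ →
    let I = kernel φ in
    (⟦ S ⟧ ≐ ∅ → I ≐ principalIdeal X)
    × (⟦ S ⟧ ≐ ｛0｝ → I ≐ principalIdeal (X +ₚ -ₚ 1ₚ))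
    × (¬ (⟦ S ⟧ ≐ ∅) → ¬ (⟦ S ⟧ ≐ ｛0｝) → ⟦ S ⟧ ≐ twice ⟦ S ⟧ →
    I ≐ principalIdeal (X *ₚ (X +ₚ -ₚ 1ₚ)))
    × (⟦ S ⟧ ≐ U →
    ¬ (⟦ S ⟧ ≐ ∅) × ¬ (⟦ S ⟧ ≐ ｛0｝) × ⟦ S ⟧ ≐ twice ⟦ S ⟧
    × I ≐ principalIdeal (X *ₚ (X +ₚ -ₚ 1ₚ)))
    × (¬ (⟦ S ⟧ ≐ ∅) → ¬ (⟦ S ⟧ ≐ ｛0｝) → ¬ (⟦ S ⟧ ≐ twice ⟦ S ⟧) →
    I ≐ principalIdeal 0ₚ)
    × (¬ (⟦ S ⟧ ≐ ∅) → ¬ (⟦ S ⟧ ≐ ｛0｝) → Bounded ⟦ S ⟧ →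
    ¬ (⟦ S ⟧ ≐ twice ⟦ S ⟧) × I ≐ principalIdeal 0ₚ)
mainTheorem1 ℝ d d≥1 𝓐 S φ φ-hom φX≈S _ =
  kernel-∅ φ φ-hom φX≈S ,
  kernel-｛0｝ φ φ-hom φX≈S ,
  kernel-cone φ φ-hom φX≈S ,
  (λ S≐U → let S≭∅ , S≭0 , S≐2S = whole-space-cone ℝ d d≥1 S S≐U in
    S≭∅ , S≭0 , S≐2S , kernel-cone φ φ-hom φX≈S S≭∅ S≭0 S≐2S) ,
  (λ _ _ → kernel-≭twice φ φ-hom φX≈S) ,
  (λ S≭∅ S≭0 bounded →
    -- The claim is a negation, so a nonzero point known up to double negation is enough.
    let S≭2S = λ S≐2S → ¬¬nonzero-point S≭∅ S≭0 λ (s , s∈S , s≉0) →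
          bounded⇒≭twice S bounded s∈S s≉0 S≐2S in
    S≭2S , kernel-≭twice φ φ-hom φX≈S S≭2S)
  where
  open Geometry ℝ d
  open Kernel ℝ d 𝓐 S
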